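{- Let $b\ge 2$ be an integer which is not a proper power. Let $g:\mathbb{N}\to\mathbb{R}$ be a continuous non-decreasing function such that $\frac{g(n+1)}{g(n)}\to 1$ as $n\to\infty$. Let $f:\mathbb{N}\to\mathbb{N}$ be a non-decreasing function such that $\frac{f(n+1)}{f(n)}\sim g(n)$ as $n\to\infty$, and denote by $\alpha$ the real number whose base-$b$ expansion is $0.f(1)f(2)f(3)\ldots$, i.e. the digits of $\alpha$ after the point are obtained by concatenating the base-$b$ representations of $f(1),f(2),f(3),\ldots$ in this order. Suppose that $\alpha$ is rational. Then $g(n)$ converges to some constant $c$ as $n\to\infty$, $c$ is a power of $b$, and $f(n+1)=c f(n)+\mathcal{O}(1)$.
   Context: $\mathbb{N}$ denotes the set of positive integers (with its discrete topology, so continuity of $g$ is no restriction). An integer $b$ is a proper power if $b=a^m$ for integers $a$ and $m\ge2$. "Power of $b$" means $b^k$ for some integer $k\ge 0$. The notation $u(n)\sim v(n)$ means $u(n)/v(n)\to1$ as $n\to\infty$. The statement $f(n+1)=cf(n)+\mathcal{O}(1)$ means that $f(n+1)-cf(n)$ is bounded as a function of $n$. -}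

module Defs where

open import Data.Digit using (Digit; Expansion; toDigits; fromDigits)
open import Data.Fin.Base using (toℕ)
open import Data.Fin.Properties using (toℕ<n)
open import Data.Integer.Base as ℤ using (ℤ; +_; -[1+_])
import Data.Integer.Properties as ℤ
open import Data.List.Base using (List; []; _∷_)
open import Data.List.NonEmpty using (List⁺; _∷_; head; tail; reverse)
open import Data.Nat.Base as ℕ using (ℕ; zero; suc; NonZero)
import Data.Nat.Properties as ℕ
open import Data.Product.Base using (∃; ∃-syntax; ∃₂; Σ-syntax; _×_; _,_; proj₁; proj₂)
open import Data.Rational.Base as ℚ using (ℚ; 0ℚ; 1ℚ; ½; toℚᵘ)
import Data.Rational.Properties as ℚ
open import Data.Rational.Solver using (module +-*-Solver)
import Data.Rational.Unnormalised.Base as ℚᵘ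
import Data.Rational.Unnormalised.Properties as ℚᵘ
open import Data.Sum.Base using (_⊎_; inj₁; inj₂)
open import Function.Base using (_∘_)
open import Relation.Binary.PropositionalEquality
  using (_≡_; _≢_; refl; sym; trans; cong; cong₂; subst; subst₂)
open import Relation.Nullary.Decidable using (fromWitness; yes; no)
open import Relation.Nullary.Negation using (contradiction)
open import Algebra.Definitions.RawSemiring ℚ.+-*-rawSemiring using (_^_)

private
  open +-*-Solver

  ∣-∣-comm : ∀ a b → ℚ.∣ a ℚ.- b ∣ ≡ ℚ.∣ b ℚ.- a ∣
  ∣-∣-comm a b = trans (sym (ℚ.∣-p∣≡∣p∣ (a ℚ.- b)))
    (cong ℚ.∣_∣ (solve 2 (λ a b → :- (a :- b) := b :- a) refl a b))

  p≤∣p∣ : ∀ p → p ℚ.≤ ℚ.∣ p ∣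
  p≤∣p∣ p with ℚ.≤-total 0ℚ p
  ... | inj₁ 0≤p = ℚ.≤-reflexive (sym (ℚ.0≤p⇒∣p∣≡p 0≤p))
  ... | inj₂ p≤0 = ℚ.≤-trans p≤0 (ℚ.0≤∣p∣ p)

  -p≤∣p∣ : ∀ p → ℚ.- p ℚ.≤ ℚ.∣ p ∣
  -p≤∣p∣ p = subst (ℚ.- p ℚ.≤_) (ℚ.∣-p∣≡∣p∣ p) (p≤∣p∣ (ℚ.- p))

  ≤∧-≤⇒∣∣≤ : ∀ {p q} → p ℚ.≤ q → ℚ.- p ℚ.≤ q → ℚ.∣ p ∣ ℚ.≤ q
  ≤∧-≤⇒∣∣≤ {p} p≤q -p≤q with ℚ.∣p∣≡p∨∣p∣≡-p p
  ... | inj₁ eq = subst (ℚ._≤ _) (sym eq) p≤q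
  ... | inj₂ eq = subst (ℚ._≤ _) (sym eq) -p≤q

  ∣p∣≤∣q∣+∣p-q∣ : ∀ p q → ℚ.∣ p ∣ ℚ.≤ ℚ.∣ q ∣ ℚ.+ ℚ.∣ p ℚ.- q ∣
  ∣p∣≤∣q∣+∣p-q∣ p q = subst (λ t → ℚ.∣ t ∣ ℚ.≤ ℚ.∣ q ∣ ℚ.+ ℚ.∣ p ℚ.- q ∣)
    (solve 2 (λ p q → q :+ (p :- q) := p) refl p q)
    (ℚ.∣p+q∣≤∣p∣+∣q∣ q (p ℚ.- q))

  p≤r+q⇒p-q≤r : ∀ {p q r} → p ℚ.≤ q ℚ.+ r → p ℚ.- q ℚ.≤ r
  p≤r+q⇒p-q≤r {p} {q} {r} h = subst (p ℚ.- q ℚ.≤_)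
    (solve 2 (λ q r → (q :+ r) :- q := r) refl q r)
    (ℚ.+-monoˡ-≤ (ℚ.- q) h)

  ∣-∣-reverse : ∀ p q → ℚ.∣ ℚ.∣ p ∣ ℚ.- ℚ.∣ q ∣ ∣ ℚ.≤ ℚ.∣ p ℚ.- q ∣
  ∣-∣-reverse p q = ≤∧-≤⇒∣∣≤
    (p≤r+q⇒p-q≤r (∣p∣≤∣q∣+∣p-q∣ p q))
    (subst₂ ℚ._≤_
      (solve 2 (λ a b → b :- a := :- (a :- b)) refl ℚ.∣ p ∣ ℚ.∣ q ∣)
      (∣-∣-comm q p)
      (p≤r+q⇒p-q≤r (∣p∣≤∣q∣+∣p-q∣ q p)))

  pos-* : ∀ {p q} → 0ℚ ℚ.< p → 0ℚ ℚ.< q → 0ℚ ℚ.< p ℚ.* q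
  pos-* {p} {q} 0<p 0<q = ℚ.positive⁻¹ (p ℚ.* q)
    {{ℚ.pos*pos⇒pos p {{ℚ.positive 0<p}} q {{ℚ.positive 0<q}}}}

  half-pos : ∀ {p} → 0ℚ ℚ.< p → 0ℚ ℚ.< ½ ℚ.* p
  half-pos 0<p = pos-* (ℚ.positive⁻¹ ½) 0<p

  half+half : ∀ p → ½ ℚ.* p ℚ.+ ½ ℚ.* p ≡ p
  half+half p = trans (sym (ℚ.*-distribʳ-+ p ½ ½)) (ℚ.*-identityˡ p)

  *-mono-≤ : ∀ {p q r s} → 0ℚ ℚ.≤ r → 0ℚ ℚ.≤ q → p ℚ.≤ q → r ℚ.≤ s →
             p ℚ.* r ℚ.≤ q ℚ.* s
  *-mono-≤ {p} {q} {r} {s} 0≤r 0≤q p≤q r≤s = ℚ.≤-trans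
    (ℚ.*-monoʳ-≤-nonNeg r {{ℚ.nonNegative 0≤r}} p≤q)
    (ℚ.*-monoˡ-≤-nonNeg q {{ℚ.nonNegative 0≤q}} r≤s)

  divPos : ∀ {ε B} → 0ℚ ℚ.< ε → 0ℚ ℚ.< B → ∃[ δ ] 0ℚ ℚ.< δ × B ℚ.* δ ≡ ε
  divPos {ε} {B} 0<ε 0<B = B⁻¹ ℚ.* ε , pos-* 0<B⁻¹ 0<ε ,
    trans (sym (ℚ.*-assoc B B⁻¹ ε))
      (trans (cong (ℚ._* ε) (ℚ.*-inverseʳ B {{B≢0}})) (ℚ.*-identityˡ ε))
    where
    B≢0 : ℚ.NonZero B
    B≢0 = ℚ.pos⇒nonZero B {{ℚ.positive 0<B}}
    B⁻¹ = ℚ.1/_ B {{B≢0}}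
    0<B⁻¹ : 0ℚ ℚ.< B⁻¹
    0<B⁻¹ = ℚ.positive⁻¹ B⁻¹ {{ℚ.1/pos⇒pos B {{ℚ.positive 0<B}}}}

-- The inverse in ℚ, with junk value 0 at 0.
inv : ℚ → ℚ
inv q with q ℚ.≟ 0ℚ
... | yes _   = 0ℚ
... | no  q≢0 = ℚ.1/_ q {{ℚ.≢-nonZero q≢0}}

inv-inverse : ∀ {q} → q ≢ 0ℚ → inv q ℚ.* q ≡ 1ℚ
inv-inverse {q} q≢0 with q ℚ.≟ 0ℚ
... | yes q≡0 = contradiction q≡0 q≢0
... | no  q≢0 = ℚ.*-inverseˡ q {{ℚ.≢-nonZero q≢0}}

-- Cauchy sequences of rationals with a modulus of convergence; equality of
-- reals is _≃_, never _≡_.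
record ℝ : Set where
  field
    seq    : ℕ → ℚ
    cauchy : ∀ ε → 0ℚ ℚ.< ε →
             ∃[ N ] ∀ m n → N ℕ.≤ m → N ℕ.≤ n → ℚ.∣ seq m ℚ.- seq n ∣ ℚ.< ε

open ℝ public

infix 4 _≃_ _<_ _≤_ _#_

_≃_ : ℝ → ℝ → Set
x ≃ y = ∀ ε → 0ℚ ℚ.< ε → ∃[ N ] ∀ n → N ℕ.≤ n → ℚ.∣ seq x n ℚ.- seq y n ∣ ℚ.< ε

_<_ : ℝ → ℝ → Set
x < y = ∃[ δ ] 0ℚ ℚ.< δ × (∃[ N ] ∀ n → N ℕ.≤ n → seq x n ℚ.+ δ ℚ.≤ seq y n)

_≤_ : ℝ → ℝ → Set
x ≤ y = ∀ ε → 0ℚ ℚ.< ε → ∃[ N ] ∀ n → N ℕ.≤ n → seq x n ℚ.≤ seq y n ℚ.+ ε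

-- Apartness: the constructive counterpart of x ≠ y.
_#_ : ℝ → ℝ → Set
x # y = x < y ⊎ y < x

fromℚ : ℚ → ℝ
fromℚ q .seq    = λ _ → q
fromℚ q .cauchy = λ ε 0<ε → 0 , λ _ _ _ _ →
  subst (ℚ._< ε) (sym (cong ℚ.∣_∣ (ℚ.+-inverseʳ q))) 0<ε

fromℕ : ℕ → ℝ
fromℕ n = fromℚ (+ n ℚ./ 1)

0ℝ 1ℝ : ℝ
0ℝ = fromℚ 0ℚ
1ℝ = fromℚ 1ℚ

infixl 6 _-_
infixl 7 _*_ _÷_[_]

_-_ : ℝ → ℝ → ℝ
(x - y) .seq n = seq x n ℚ.- seq y n
(x - y) .cauchy ε 0<ε =
  let Nx , hx = cauchy x (½ ℚ.* ε) (half-pos 0<ε)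
      Ny , hy = cauchy y (½ ℚ.* ε) (half-pos 0<ε)
  in Nx ℕ.⊔ Ny , λ m n N≤m N≤n →
    let a = seq x m
        b = seq x n
        c = seq y m
        d = seq y n
        open ℚ.≤-Reasoning
    in begin-strict
      ℚ.∣ (a ℚ.- c) ℚ.- (b ℚ.- d) ∣
        ≡⟨ cong ℚ.∣_∣ (solve 4 (λ a b c d →
             (a :- c) :- (b :- d) := (a :- b) :- (c :- d)) refl a b c d) ⟩
      ℚ.∣ (a ℚ.- b) ℚ.- (c ℚ.- d) ∣
        ≤⟨ ℚ.∣p-q∣≤∣p∣+∣q∣ (a ℚ.- b) (c ℚ.- d) ⟩
      ℚ.∣ a ℚ.- b ∣ ℚ.+ ℚ.∣ c ℚ.- d ∣
        <⟨ ℚ.+-mono-<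
             (hx m n (ℕ.m⊔n≤o⇒m≤o Nx Ny N≤m) (ℕ.m⊔n≤o⇒m≤o Nx Ny N≤n))
             (hy m n (ℕ.m⊔n≤o⇒n≤o Nx Ny N≤m) (ℕ.m⊔n≤o⇒n≤o Nx Ny N≤n)) ⟩
      ½ ℚ.* ε ℚ.+ ½ ℚ.* ε
        ≡⟨ half+half ε ⟩
      ε ∎

∣_∣ : ℝ → ℝ
∣ x ∣ .seq n = ℚ.∣ seq x n ∣
∣ x ∣ .cauchy ε 0<ε =
  let N , h = cauchy x ε 0<ε
  in N , λ m n N≤m N≤n →
    ℚ.≤-<-trans (∣-∣-reverse (seq x m) (seq x n)) (h m n N≤m N≤n)

private
  eventuallyBounded : ∀ x → ∃[ B ] 0ℚ ℚ.< B ×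
    (∃[ N ] ∀ n → N ℕ.≤ n → ℚ.∣ seq x n ∣ ℚ.≤ B)
  eventuallyBounded x =
    let N , h = cauchy x 1ℚ (ℚ.positive⁻¹ 1ℚ)
        B     = ℚ.∣ seq x N ∣ ℚ.+ 1ℚ
    in B ,
       ℚ.<-≤-trans (ℚ.positive⁻¹ 1ℚ)
         (subst (ℚ._≤ B) (ℚ.+-identityˡ 1ℚ) (ℚ.+-monoˡ-≤ 1ℚ (ℚ.0≤∣p∣ (seq x N)))) ,
       N , λ n N≤n → ℚ.≤-trans (∣p∣≤∣q∣+∣p-q∣ (seq x n) (seq x N))
         (ℚ.+-monoʳ-≤ ℚ.∣ seq x N ∣ (ℚ.<⇒≤ (h n N N≤n ℕ.≤-refl)))

_*_ : ℝ → ℝ → ℝ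
(x * y) .seq n = seq x n ℚ.* seq y n
(x * y) .cauchy ε 0<ε =
  let A , 0<A , M , bx   = eventuallyBounded x
      B , 0<B , N , by   = eventuallyBounded y
      δx , 0<δx , Bδx≡½ε = divPos (half-pos 0<ε) 0<B
      δy , 0<δy , Aδy≡½ε = divPos (half-pos 0<ε) 0<A
      Nx , hx = cauchy x δx 0<δx
      Ny , hy = cauchy y δy 0<δy
      K = (M ℕ.⊔ N) ℕ.⊔ (Nx ℕ.⊔ Ny)
      M≤ : ∀ {k} → K ℕ.≤ k → M ℕ.≤ k
      M≤ h = ℕ.m⊔n≤o⇒m≤o M N (ℕ.m⊔n≤o⇒m≤o (M ℕ.⊔ N) (Nx ℕ.⊔ Ny) h)
      N≤ : ∀ {k} → K ℕ.≤ k → N ℕ.≤ k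
      N≤ h = ℕ.m⊔n≤o⇒n≤o M N (ℕ.m⊔n≤o⇒m≤o (M ℕ.⊔ N) (Nx ℕ.⊔ Ny) h)
      Nx≤ : ∀ {k} → K ℕ.≤ k → Nx ℕ.≤ k
      Nx≤ h = ℕ.m⊔n≤o⇒m≤o Nx Ny (ℕ.m⊔n≤o⇒n≤o (M ℕ.⊔ N) (Nx ℕ.⊔ Ny) h)
      Ny≤ : ∀ {k} → K ℕ.≤ k → Ny ℕ.≤ k
      Ny≤ h = ℕ.m⊔n≤o⇒n≤o Nx Ny (ℕ.m⊔n≤o⇒n≤o (M ℕ.⊔ N) (Nx ℕ.⊔ Ny) h)
  in K , λ m n K≤m K≤n →
    let a = seq x m
        b = seq x n
        c = seq y m
        d = seq y n
        open ℚ.≤-Reasoning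
    in begin-strict
      ℚ.∣ a ℚ.* c ℚ.- b ℚ.* d ∣
        ≡⟨ cong ℚ.∣_∣ (solve 4 (λ a b c d →
             a :* c :- b :* d := d :* (a :- b) :+ a :* (c :- d)) refl a b c d) ⟩
      ℚ.∣ d ℚ.* (a ℚ.- b) ℚ.+ a ℚ.* (c ℚ.- d) ∣
        ≤⟨ ℚ.∣p+q∣≤∣p∣+∣q∣ (d ℚ.* (a ℚ.- b)) (a ℚ.* (c ℚ.- d)) ⟩
      ℚ.∣ d ℚ.* (a ℚ.- b) ∣ ℚ.+ ℚ.∣ a ℚ.* (c ℚ.- d) ∣
        ≡⟨ cong₂ ℚ._+_ (ℚ.∣p*q∣≡∣p∣*∣q∣ d (a ℚ.- b)) (ℚ.∣p*q∣≡∣p∣*∣q∣ a (c ℚ.- d)) ⟩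
      ℚ.∣ d ∣ ℚ.* ℚ.∣ a ℚ.- b ∣ ℚ.+ ℚ.∣ a ∣ ℚ.* ℚ.∣ c ℚ.- d ∣
        ≤⟨ ℚ.+-mono-≤
             (ℚ.*-monoʳ-≤-nonNeg ℚ.∣ a ℚ.- b ∣ {{ℚ.∣-∣-nonNeg (a ℚ.- b)}} (by n (N≤ K≤n)))
             (ℚ.*-monoʳ-≤-nonNeg ℚ.∣ c ℚ.- d ∣ {{ℚ.∣-∣-nonNeg (c ℚ.- d)}} (bx m (M≤ K≤m))) ⟩
      B ℚ.* ℚ.∣ a ℚ.- b ∣ ℚ.+ A ℚ.* ℚ.∣ c ℚ.- d ∣
        <⟨ ℚ.+-mono-<
             (ℚ.*-monoʳ-<-pos B {{ℚ.positive 0<B}} (hx m n (Nx≤ K≤m) (Nx≤ K≤n)))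
             (ℚ.*-monoʳ-<-pos A {{ℚ.positive 0<A}} (hy m n (Ny≤ K≤m) (Ny≤ K≤n))) ⟩
      B ℚ.* δx ℚ.+ A ℚ.* δy
        ≡⟨ cong₂ ℚ._+_ Bδx≡½ε Aδy≡½ε ⟩
      ½ ℚ.* ε ℚ.+ ½ ℚ.* ε
        ≡⟨ half+half ε ⟩
      ε ∎

private
  #0⇒boundedBelow : ∀ x → x # 0ℝ → ∃[ δ ] 0ℚ ℚ.< δ ×
    (∃[ N ] ∀ n → N ℕ.≤ n → δ ℚ.≤ ℚ.∣ seq x n ∣)
  #0⇒boundedBelow x (inj₁ (δ , 0<δ , N , h)) = δ , 0<δ , N , λ n N≤n →
    ℚ.≤-trans
      (subst₂ ℚ._≤_
        (solve 2 (λ a δ → (a :+ δ) :+ (:- a) := δ) refl (seq x n) δ)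
        (ℚ.+-identityˡ (ℚ.- seq x n))
        (ℚ.+-monoˡ-≤ (ℚ.- seq x n) (h n N≤n)))
      (-p≤∣p∣ (seq x n))
  #0⇒boundedBelow x (inj₂ (δ , 0<δ , N , h)) = δ , 0<δ , N , λ n N≤n →
    ℚ.≤-trans (subst (ℚ._≤ seq x n) (ℚ.+-identityˡ δ) (h n N≤n)) (p≤∣p∣ (seq x n))

  inv-lipschitz : ∀ {δ p q} → 0ℚ ℚ.< δ → δ ℚ.≤ ℚ.∣ p ∣ → δ ℚ.≤ ℚ.∣ q ∣ →
    (δ ℚ.* δ) ℚ.* ℚ.∣ inv p ℚ.- inv q ∣ ℚ.≤ ℚ.∣ p ℚ.- q ∣
  inv-lipschitz {δ} {p} {q} 0<δ δ≤p δ≤q = begin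
    (δ ℚ.* δ) ℚ.* ℚ.∣ r ∣
      ≤⟨ ℚ.*-monoʳ-≤-nonNeg ℚ.∣ r ∣ {{ℚ.∣-∣-nonNeg r}}
           (*-mono-≤ (ℚ.<⇒≤ 0<δ) (ℚ.0≤∣p∣ p) δ≤p δ≤q) ⟩
    (ℚ.∣ p ∣ ℚ.* ℚ.∣ q ∣) ℚ.* ℚ.∣ r ∣
      ≡⟨ cong (ℚ._* ℚ.∣ r ∣) (sym (ℚ.∣p*q∣≡∣p∣*∣q∣ p q)) ⟩
    ℚ.∣ p ℚ.* q ∣ ℚ.* ℚ.∣ r ∣
      ≡⟨ sym (ℚ.∣p*q∣≡∣p∣*∣q∣ (p ℚ.* q) r) ⟩
    ℚ.∣ (p ℚ.* q) ℚ.* r ∣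
      ≡⟨ cong ℚ.∣_∣ (solve 4 (λ p q u v →
           (p :* q) :* (u :- v) := (u :* p) :* q :- (v :* q) :* p) refl p q (inv p) (inv q)) ⟩
    ℚ.∣ (inv p ℚ.* p) ℚ.* q ℚ.- (inv q ℚ.* q) ℚ.* p ∣
      ≡⟨ cong₂ (λ s t → ℚ.∣ s ℚ.* q ℚ.- t ℚ.* p ∣)
           (inv-inverse (≢0 δ≤p)) (inv-inverse (≢0 δ≤q)) ⟩
    ℚ.∣ 1ℚ ℚ.* q ℚ.- 1ℚ ℚ.* p ∣
      ≡⟨ cong₂ (λ s t → ℚ.∣ s ℚ.- t ∣) (ℚ.*-identityˡ q) (ℚ.*-identityˡ p) ⟩
    ℚ.∣ q ℚ.- p ∣
      ≡⟨ ∣-∣-comm q p ⟩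
    ℚ.∣ p ℚ.- q ∣ ∎
    where
    open ℚ.≤-Reasoning
    r = inv p ℚ.- inv q
    ≢0 : ∀ {s} → δ ℚ.≤ ℚ.∣ s ∣ → s ≢ 0ℚ
    ≢0 δ≤s refl = ℚ.<-irrefl refl (ℚ.<-≤-trans 0<δ δ≤s)

recip : (x : ℝ) → x # 0ℝ → ℝ
recip x x#0 .seq n = inv (seq x n)
recip x x#0 .cauchy ε 0<ε =
  let δ , 0<δ , M , below = #0⇒boundedBelow x x#0
      δ² = δ ℚ.* δ
      0<δ² = pos-* 0<δ 0<δ
      N , h = cauchy x (δ² ℚ.* ε) (pos-* 0<δ² 0<ε)
  in M ℕ.⊔ N , λ m n K≤m K≤n →
    ℚ.*-cancelˡ-<-nonNeg δ² {{ℚ.nonNegative (ℚ.<⇒≤ 0<δ²)}}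
      (ℚ.≤-<-trans
        (inv-lipschitz 0<δ (below m (ℕ.m⊔n≤o⇒m≤o M N K≤m)) (below n (ℕ.m⊔n≤o⇒m≤o M N K≤n)))
        (h m n (ℕ.m⊔n≤o⇒n≤o M N K≤m) (ℕ.m⊔n≤o⇒n≤o M N K≤n)))

_÷_[_] : (x y : ℝ) → y # 0ℝ → ℝ
x ÷ y [ y#0 ] = x * recip y y#0

Rational : ℝ → Set
Rational x = ∃[ q ] x ≃ fromℚ q

record ℕ⁺ : Set where
  constructor pos
  field
    value        : ℕ
    .{{nonZero}} : NonZero value

open ℕ⁺ public using (value)

value-nonZero : ∀ n → NonZero (value n)
value-nonZero (pos (suc _)) = _

suc⁺ : ℕ⁺ → ℕ⁺
suc⁺ n = pos (suc (value n))

infixl 7 _/⁺_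

_/⁺_ : ℕ⁺ → ℕ⁺ → ℝ
m /⁺ n = fromℚ (ℚ._/_ (+ value m) (value n) {{value-nonZero n}})

infix 4 _⟶_ _∼_

_⟶_ : (ℕ⁺ → ℝ) → ℝ → Set
u ⟶ l = ∀ ε → 0ℝ < ε → ∃[ N ] ∀ n → N ℕ.≤ value n → ∣ u n - l ∣ < ε

-- u(n)/v(n) → 1, where the quotient need only be defined for large n.
_∼_ : (ℕ⁺ → ℝ) → (ℕ⁺ → ℝ) → Set
u ∼ v = ∀ ε → 0ℝ < ε → ∃[ N ] ∀ n → N ℕ.≤ value n →
  Σ[ v#0 ∈ v n # 0ℝ ] ∣ u n ÷ v n [ v#0 ] - 1ℝ ∣ < ε

Bounded : (ℕ⁺ → ℝ) → Set
Bounded u = ∃[ B ] ∀ n → ∣ u n ∣ ≤ B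

ProperPower : ℤ → Set
ProperPower i = ∃₂ λ (a : ℤ) (m : ℕ) → 2 ℕ.≤ m × i ≡ a ℤ.^ m

PowerOf : ℕ → ℝ → Set
PowerOf b x = ∃[ k ] x ≃ fromℕ (b ℕ.^ k)

-- Most significant digit first, without leading zeros; toDigits is least
-- significant digit first.
digits : ∀ b → 2 ℕ.≤ b → ℕ⁺ → List⁺ (Digit b)
digits b 2≤b n with toDigits b {fromWitness 2≤b} (value n)
... | d ∷ ds , _  = reverse (d ∷ ds)
... | []     , eq = contradiction (sym eq) (ℕ.≢-nonZero⁻¹ (value n) {{value-nonZero n}})

module _ {A : Set} where

  infixr 5 _++concat_

  -- The infinite word xs w₀ w₁ w₂ ….
  _++concat_ : List A → (ℕ → List⁺ A) → ℕ → A
  ((x ∷ xs) ++concat w) zero    = x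
  ((x ∷ xs) ++concat w) (suc i) = (xs ++concat w) i
  ([]       ++concat w) zero    = head (w 0)
  ([]       ++concat w) (suc i) = (tail (w 0) ++concat (w ∘ suc)) i

  concat∞ : (ℕ → List⁺ A) → ℕ → A
  concat∞ w = [] ++concat w

private
  ι : ℕ → ℚ
  ι n = + n ℚ./ 1

  ι≃ : ∀ n → toℚᵘ (ι n) ℚᵘ.≃ ℚᵘ.mkℚᵘ (+ n) 0
  ι≃ n = ℚ.toℚᵘ-fromℚᵘ (ℚᵘ.mkℚᵘ (+ n) 0)

  ι-mono-≤ : ∀ {m n} → m ℕ.≤ n → ι m ℚ.≤ ι n
  ι-mono-≤ {m} {n} m≤n = ℚ.toℚᵘ-cancel-≤
    (ℚᵘ.≤-respˡ-≃ (ℚᵘ.≃-sym (ι≃ m)) (ℚᵘ.≤-respʳ-≃ (ℚᵘ.≃-sym (ι≃ n))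
      (ℚᵘ.*≤* (ℤ.*-monoʳ-≤-nonNeg (+ 1) (ℤ.+≤+ m≤n)))))

  ι-mono-< : ∀ {m n} → m ℕ.< n → ι m ℚ.< ι n
  ι-mono-< {m} {n} m<n = ℚ.toℚᵘ-cancel-<
    (ℚᵘ.<-respˡ-≃ (ℚᵘ.≃-sym (ι≃ m)) (ℚᵘ.<-respʳ-≃ (ℚᵘ.≃-sym (ι≃ n))
      (ℚᵘ.*<* (ℤ.*-monoʳ-<-pos (+ 1) (ℤ.+<+ m<n)))))

  ι-* : ∀ m n → ι (m ℕ.* n) ≡ ι m ℚ.* ι n
  ι-* m n = ℚ.toℚᵘ-injective (begin
    toℚᵘ (ι (m ℕ.* n))                      ≈⟨ ι≃ (m ℕ.* n) ⟩
    ℚᵘ.mkℚᵘ (+ (m ℕ.* n)) 0                 ≈⟨ ℚᵘ.*≡* (cong (ℤ._* + 1) (ℤ.pos-* m n)) ⟩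
    ℚᵘ.mkℚᵘ (+ m) 0 ℚᵘ.* ℚᵘ.mkℚᵘ (+ n) 0    ≈⟨ ℚᵘ.*-cong (ι≃ m) (ι≃ n) ⟨
    toℚᵘ (ι m) ℚᵘ.* toℚᵘ (ι n)              ≈⟨ ℚ.toℚᵘ-homo-* (ι m) (ι n) ⟨
    toℚᵘ (ι m ℚ.* ι n)                      ∎)
    where open ℚᵘ.≃-Reasoning

  ι-suc : ∀ n → ι (suc n) ≡ ι n ℚ.+ 1ℚ
  ι-suc n = ℚ.toℚᵘ-injective (begin
    toℚᵘ (ι (suc n))              ≈⟨ ι≃ (suc n) ⟩
    ℚᵘ.mkℚᵘ (+ suc n) 0           ≈⟨ ℚᵘ.*≡* (cong (ℤ._* + 1) (trans
                                       (cong +_ (ℕ.+-comm 1 n))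
                                       (cong (ℤ._+ + 1) (sym (ℤ.*-identityʳ (+ n)))))) ⟩
    ℚᵘ.mkℚᵘ (+ n) 0 ℚᵘ.+ toℚᵘ 1ℚ  ≈⟨ ℚᵘ.+-congˡ (toℚᵘ 1ℚ) (ι≃ n) ⟨
    toℚᵘ (ι n) ℚᵘ.+ toℚᵘ 1ℚ       ≈⟨ ℚ.toℚᵘ-homo-+ (ι n) 1ℚ ⟨
    toℚᵘ (ι n ℚ.+ 1ℚ)             ∎)
    where open ℚᵘ.≃-Reasoning

  ι-reciprocal : ∀ n .{{_ : NonZero n}} → ι n ℚ.* (+ 1 ℚ./ n) ≡ 1ℚ
  ι-reciprocal n@(suc k) = ℚ.toℚᵘ-injective (begin
    toℚᵘ (ι n ℚ.* (+ 1 ℚ./ n))             ≈⟨ ℚ.toℚᵘ-homo-* (ι n) (+ 1 ℚ./ n) ⟩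
    toℚᵘ (ι n) ℚᵘ.* toℚᵘ (+ 1 ℚ./ n)       ≈⟨ ℚᵘ.*-cong (ι≃ n) (ℚ.toℚᵘ-fromℚᵘ (ℚᵘ.mkℚᵘ (+ 1) k)) ⟩
    ℚᵘ.mkℚᵘ (+ n) 0 ℚᵘ.* ℚᵘ.mkℚᵘ (+ 1) k   ≈⟨ ℚᵘ.*≡* (trans (ℤ.*-identityʳ (+ n ℤ.* + 1))
                                                (trans (ℤ.*-identityʳ (+ n))
                                                  (sym (trans (ℤ.*-identityˡ (+ (1 ℕ.* n)))
                                                    (cong +_ (ℕ.*-identityˡ n)))))) ⟩
    toℚᵘ 1ℚ                                ∎)
    where open ℚᵘ.≃-Reasoning

  archimedean : ∀ ε → 0ℚ ℚ.< ε → ∃[ q ] 1ℚ ℚ.≤ ε ℚ.* ι q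
  archimedean ε 0<ε = q , (begin
    1ℚ                           ≡⟨ sym (ℚ.*-inverseʳ ε {{ε≢0}}) ⟩
    ε ℚ.* ε⁻¹                    ≤⟨ ℚ.*-monoˡ-≤-nonNeg ε {{ℚ.nonNegative (ℚ.<⇒≤ 0<ε)}} (≤ι ε⁻¹) ⟩
    ε ℚ.* ι q                    ∎)
    where
    open ℚ.≤-Reasoning
    ε≢0 : ℚ.NonZero ε
    ε≢0 = ℚ.pos⇒nonZero ε {{ℚ.positive 0<ε}}
    ε⁻¹ = ℚ.1/_ ε {{ε≢0}}
    q = ℤ.∣ ℚ.↥ ε⁻¹ ∣
    ≤ι : ∀ p → p ℚ.≤ ι ℤ.∣ ℚ.↥ p ∣
    ≤ι p@(ℚ.mkℚ (+ n) k _) = ℚ.toℚᵘ-cancel-≤ (ℚᵘ.≤-respʳ-≃ (ℚᵘ.≃-sym (ι≃ n))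
      (ℚᵘ.*≤* (ℤ.*-monoˡ-≤-nonNeg (+ n) (ℤ.+≤+ (ℕ.s≤s ℕ.z≤n)))))
    ≤ι p@(ℚ.mkℚ -[1+ n ] k _) = ℚ.toℚᵘ-cancel-≤ (ℚᵘ.≤-respʳ-≃ (ℚᵘ.≃-sym (ι≃ (suc n)))
      (ℚᵘ.*≤* ℤ.-≤+))

module _ (b : ℕ) (2≤b : 2 ℕ.≤ b) where

  private
    instance
      b≢0 : NonZero b
      b≢0 = ℕ.>-nonZero (ℕ.≤-trans (ℕ.s≤s ℕ.z≤n) 2≤b)

  1/b : ℚ
  1/b = + 1 ℚ./ b

  -- d₀ / b + d₁ / b² + ⋯ + dₙ₋₁ / bⁿ
  partialSum : (ℕ → Digit b) → ℕ → ℚ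
  partialSum d zero    = 0ℚ
  partialSum d (suc n) = partialSum d n ℚ.+ (+ toℕ (d n) ℚ./ 1) ℚ.* 1/b ^ suc n

  private
    0<1/b : 0ℚ ℚ.< 1/b
    0<1/b = ℚ.positive⁻¹ 1/b {{ℚ.normalize-pos 1 b}}

    0<1/b^ : ∀ n → 0ℚ ℚ.< 1/b ^ n
    0<1/b^ zero    = ℚ.positive⁻¹ 1ℚ
    0<1/b^ (suc n) = pos-* 0<1/b (0<1/b^ n)

    b*1/b^ : ∀ n → ι b ℚ.* 1/b ^ suc n ≡ 1/b ^ n
    b*1/b^ n = trans (sym (ℚ.*-assoc (ι b) 1/b (1/b ^ n)))
      (trans (cong (ℚ._* 1/b ^ n) (ι-reciprocal b)) (ℚ.*-identityˡ (1/b ^ n)))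

    b^*1/b^ : ∀ n → 1/b ^ n ℚ.* ι (b ℕ.^ n) ≡ 1ℚ
    b^*1/b^ zero    = refl
    b^*1/b^ (suc n) = trans (cong (1/b ^ suc n ℚ.*_) (ι-* b (b ℕ.^ n)))
      (trans (solve 3 (λ x y z → x :* (y :* z) := (y :* x) :* z) refl
               (1/b ^ suc n) (ι b) (ι (b ℕ.^ n)))
        (trans (cong (ℚ._* ι (b ℕ.^ n)) (b*1/b^ n)) (b^*1/b^ n)))

    n<b^n : ∀ n → n ℕ.< b ℕ.^ n
    n<b^n zero    = ℕ.s≤s ℕ.z≤n
    n<b^n (suc n) = ℕ.≤-<-trans (n<b^n n)
      (subst (b ℕ.^ n ℕ.<_) (ℕ.*-comm (b ℕ.^ n) b)
        (ℕ.m<m*n (b ℕ.^ n) b {{ℕ.m^n≢0 b n}} 2≤b))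

    1/b^-small : ∀ ε → 0ℚ ℚ.< ε → ∃[ n ] 1/b ^ n ℚ.< ε
    1/b^-small ε 0<ε =
      let q , 1≤εq = archimedean ε 0<ε
          instance _ = ℚ.nonNegative (ι-mono-≤ {0} {b ℕ.^ q} ℕ.z≤n)
      in q , ℚ.*-cancelʳ-<-nonNeg (ι (b ℕ.^ q))
        (ℚ.≤-<-trans (ℚ.≤-reflexive (b^*1/b^ q)) (ℚ.≤-<-trans 1≤εq
          (ℚ.*-monoʳ-<-pos ε {{ℚ.positive 0<ε}} (ι-mono-< (n<b^n q)))))

    module _ (d : ℕ → Digit b) where

      S : ℕ → ℚ
      S = partialSum d

      S-step : ∀ n → S n ℚ.≤ S (suc n)
      S-step n = begin
        S n                                       ≡⟨ sym (ℚ.+-identityʳ (S n)) ⟩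
        S n ℚ.+ 0ℚ                                ≡⟨ cong (S n ℚ.+_) (sym (ℚ.*-zeroˡ (1/b ^ suc n))) ⟩
        S n ℚ.+ 0ℚ ℚ.* 1/b ^ suc n                ≤⟨ ℚ.+-monoʳ-≤ (S n)
          (ℚ.*-monoʳ-≤-nonNeg (1/b ^ suc n) {{ℚ.nonNegative (ℚ.<⇒≤ (0<1/b^ (suc n)))}}
            (ι-mono-≤ {0} {toℕ (d n)} ℕ.z≤n)) ⟩
        S (suc n)                                 ∎
        where open ℚ.≤-Reasoning

      S+-step : ∀ n → S (suc n) ℚ.+ 1/b ^ suc n ℚ.≤ S n ℚ.+ 1/b ^ n
      S+-step n = begin
        (S n ℚ.+ ι k ℚ.* w) ℚ.+ w    ≡⟨ solve 3 (λ s k w → (s :+ k :* w) :+ w := s :+ (k :+ con 1ℚ) :* w)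
                                          refl (S n) (ι k) w ⟩
        S n ℚ.+ (ι k ℚ.+ 1ℚ) ℚ.* w   ≡⟨ cong (λ t → S n ℚ.+ t ℚ.* w) (sym (ι-suc k)) ⟩
        S n ℚ.+ ι (suc k) ℚ.* w      ≤⟨ ℚ.+-monoʳ-≤ (S n)
          (ℚ.*-monoʳ-≤-nonNeg w {{ℚ.nonNegative (ℚ.<⇒≤ (0<1/b^ (suc n)))}}
            (ι-mono-≤ (toℕ<n (d n)))) ⟩
        S n ℚ.+ ι b ℚ.* w            ≡⟨ cong (S n ℚ.+_) (b*1/b^ n) ⟩
        S n ℚ.+ 1/b ^ n              ∎
        where
        open ℚ.≤-Reasoning
        k = toℕ (d n)
        w = 1/b ^ suc n

      S-mono : ∀ {m n} → m ℕ.≤′ n → S m ℚ.≤ S n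
      S-mono ℕ.≤′-refl           = ℚ.≤-refl
      S-mono (ℕ.≤′-step {n} m≤n) = ℚ.≤-trans (S-mono m≤n) (S-step n)

      S+-antimono : ∀ {m n} → m ℕ.≤′ n → S n ℚ.+ 1/b ^ n ℚ.≤ S m ℚ.+ 1/b ^ m
      S+-antimono ℕ.≤′-refl           = ℚ.≤-refl
      S+-antimono (ℕ.≤′-step {n} m≤n) = ℚ.≤-trans (S+-step n) (S+-antimono m≤n)

      S-diff : ∀ {N m n} → N ℕ.≤ m → N ℕ.≤ n → S m ℚ.- S n ℚ.≤ 1/b ^ N
      S-diff {N} {m} {n} N≤m N≤n = p≤r+q⇒p-q≤r (begin
        S m                ≡⟨ sym (ℚ.+-identityʳ (S m)) ⟩
        S m ℚ.+ 0ℚ         ≤⟨ ℚ.+-monoʳ-≤ (S m) (ℚ.<⇒≤ (0<1/b^ m)) ⟩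
        S m ℚ.+ 1/b ^ m    ≤⟨ S+-antimono (ℕ.≤⇒≤′ N≤m) ⟩
        S N ℚ.+ 1/b ^ N    ≤⟨ ℚ.+-monoˡ-≤ (1/b ^ N) (S-mono (ℕ.≤⇒≤′ N≤n)) ⟩
        S n ℚ.+ 1/b ^ N    ∎)
        where open ℚ.≤-Reasoning

  -- The real number 0.d₀d₁d₂…
  0∙_ : (ℕ → Digit b) → ℝ
  (0∙ d) .seq = partialSum d
  (0∙ d) .cauchy ε 0<ε =
    let N , small = 1/b^-small ε 0<ε
    in N , λ m n N≤m N≤n → ℚ.≤-<-trans
      (≤∧-≤⇒∣∣≤ (S-diff d N≤m N≤n)
        (subst (ℚ._≤ 1/b ^ N)
          (solve 2 (λ x y → y :- x := :- (x :- y)) refl (S d m) (S d n))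
          (S-diff d N≤n N≤m)))
      small

  -- 0.f(1)f(2)f(3)…
  concatenation : (ℕ⁺ → ℕ⁺) → ℝ
  concatenation f = 0∙ concat∞ λ i → digits b 2≤b (f (pos (suc i)))

{-# OPTIONS --safe #-}
module Submission where

-- Let α = p / r.  The remainders t of the long division of p by r in base b
-- satisfy b tᵢ = r dᵢ + tᵢ₊₁ and 0 ≤ tᵢ ≤ r, so if the block f(n) has Lₙ digits
-- and Tₙ is the remainder in front of it, then
--   Aₙ := b ^ Lₙ · Tₙ = r f(n) + Tₙ₊₁.
-- The hypotheses on g say that consecutive ratios f(n+1) / f(n) are eventually
-- arbitrarily close, hence so are Aₙ₊₂ Aₙ and Aₙ₊₁² once f(n) is large.  Both are
-- powers of b times a cofactor of at most r², and such numbers are equal as soon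
-- as they are close enough: A is eventually geometric.  As T takes finitely many
-- values, some power of the ratio is a power of b, and then so is the ratio,
-- b not being a proper power.  If f does not become large, then it is eventually
-- constant: a step f(n+1) = f(n) < K forces f(n+2) = f(n+1), since the ratios
-- f(n+1) / f(n) and f(n+2) / f(n+1) would otherwise differ by at least 1 / K.

open import Data.Nat.Base as ℕ using (ℕ; zero; suc)
open import Data.Product.Base using (∃-syntax; _×_; _,_; proj₁; proj₂)
open import Data.Sum.Base using (_⊎_; inj₁; inj₂)
open import Function.Base using (_∘_)
open import Relation.Binary.PropositionalEquality
open import Relation.Nullary.Decidable using (fromWitness; yes; no)
open import Relation.Nullary.Negation using (¬_; contradiction)

-- Divisibility of powers and common roots of integers.

module Powers where

  open import Data.Integer.Base as ℤ using (+_)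
  import Data.Integer.Properties as ℤ
  open import Data.Nat.Base
  open import Data.Nat.Coprimality using (Coprime; coprime-/gcd; coprime-divisor)
  open import Data.Nat.Divisibility
  open import Data.Nat.DivMod using (_/_; m/n*n≡m)
  open import Data.Nat.GCD using (gcd; gcd[m,n]∣m; gcd[m,n]∣n; gcd[m,n]≢0)
  open import Data.Nat.Properties
  open import Defs using (ProperPower)

  ^-distribʳ-* : ∀ m n k → (m * n) ^ k ≡ m ^ k * n ^ k
  ^-distribʳ-* m n zero    = refl
  ^-distribʳ-* m n (suc k) =
    trans (cong (m * n *_) (^-distribʳ-* m n k)) ([m*n]*[o*p]≡[m*o]*[n*p] m n (m ^ k) (n ^ k))

  pos-^ : ∀ m k → + (m ^ k) ≡ (+ m) ℤ.^ k
  pos-^ m zero    = refl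
  pos-^ m (suc k) = trans (ℤ.pos-* m (m ^ k)) (cong (+ m ℤ.*_) (pos-^ m k))

  coprime-∣-^ : ∀ {m n} → Coprime m n → ∀ k → m ∣ n ^ k → m ≡ 1
  coprime-∣-^ c zero    m∣1  = ∣1⇒≡1 m∣1
  coprime-∣-^ c (suc k) m∣nᵏ = coprime-∣-^ c k (coprime-divisor c m∣nᵏ)

  -- After division by `g = gcd m n` the quotients are coprime, yet `m′` divides `n′ ^ k`. Hence
  -- `m′ = 1`, and `m` is the gcd itself.
  ^-cancel-∣ : ∀ {m n} k .{{_ : NonZero m}} .{{_ : NonZero k}} → m ^ k ∣ n ^ k → m ∣ n
  ^-cancel-∣ {m} {n} k@(suc k-1) mᵏ∣nᵏ = subst (_∣ n) (sym m≡g) (gcd[m,n]∣n m n)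
    where
    g = gcd m n
    instance
      g≢0 : NonZero g
      g≢0 = ≢-nonZero (gcd[m,n]≢0 m n (inj₁ (≢-nonZero⁻¹ m)))
      gᵏ≢0 : NonZero (g ^ k)
      gᵏ≢0 = m^n≢0 g k
    m′ = m / g
    n′ = n / g
    m′g≡m : m′ * g ≡ m
    m′g≡m = m/n*n≡m (gcd[m,n]∣m m n)
    n′g≡n : n′ * g ≡ n
    n′g≡n = m/n*n≡m (gcd[m,n]∣n m n)
    m′ᵏ∣n′ᵏ : m′ ^ k ∣ n′ ^ k
    m′ᵏ∣n′ᵏ = *-cancelʳ-∣ (g ^ k) (subst₂ _∣_
      (trans (cong (_^ k) (sym m′g≡m)) (^-distribʳ-* m′ g k))
      (trans (cong (_^ k) (sym n′g≡n)) (^-distribʳ-* n′ g k)) mᵏ∣nᵏ)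
    m′≡1 : m′ ≡ 1
    m′≡1 = coprime-∣-^ (coprime-/gcd m n) k (∣-trans (m∣m*n (m′ ^ k-1)) m′ᵏ∣n′ᵏ)
    m≡g : m ≡ g
    m≡g = trans (sym m′g≡m) (trans (cong (_* g) m′≡1) (*-identityˡ g))

  CommonRoot : ℕ → ℕ → Set
  CommonRoot m n = ∃[ e ] (∃[ i ] m ≡ e ^ i) × (∃[ j ] n ≡ e ^ j)

  private
    -- Euclid's algorithm on the exponents: the larger exponent belongs to a
    -- multiple of the other base, and dividing subtracts the exponents.
    commonRoot′ : ∀ fuel m n k l .{{_ : NonZero m}} .{{_ : NonZero n}} →
                  suc k + suc l ≤ fuel → m ^ suc k ≡ n ^ suc l → CommonRoot m n

    -- The fuel bounds the sum of the exponents that remain after the division, so `commonRoot′` can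
    -- hand on the predecessor of its own fuel.
    commonRoot-step : ∀ fuel m n k d .{{_ : NonZero m}} .{{_ : NonZero n}} →
                      suc k + suc d ≤ fuel → m ^ suc k ≡ n ^ (suc k + suc d) → CommonRoot m n
    commonRoot-step fuel m n k d h eq
      with divides q m≡qn ← ^-cancel-∣ {n} {m} (suc k)
             (divides (n ^ suc d) (trans eq (trans (^-distribˡ-+-* n (suc k) (suc d))
               (*-comm (n ^ suc k) (n ^ suc d)))))
      = let qᵏ≡nᵈ : q ^ suc k ≡ n ^ suc d
            qᵏ≡nᵈ = *-cancelʳ-≡ (q ^ suc k) (n ^ suc d) (n ^ suc k) {{m^n≢0 n (suc k)}}
              (trans (sym (^-distribʳ-* q n (suc k))) (trans (cong (_^ suc k) (sym m≡qn))
                (trans eq (trans (^-distribˡ-+-* n (suc k) (suc d)) (*-comm (n ^ suc k) (n ^ suc d))))))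
            e , (i , q≡eⁱ) , (j , n≡eʲ) = commonRoot′ fuel q n k d
              {{≢-nonZero λ { refl → ≢-nonZero⁻¹ m m≡qn }}} h qᵏ≡nᵈ
        in e , (i + j , trans m≡qn (trans (cong₂ _*_ q≡eⁱ n≡eʲ) (sym (^-distribˡ-+-* e i j)))) , (j , n≡eʲ)

    commonRoot′ zero       m n k l () eq
    commonRoot′ (suc fuel) m n k l (s≤s h) eq with compare k l
    ... | less    .k d = commonRoot-step fuel m n k d
            (≤-trans (+-monoʳ-≤ (suc k) (s≤s (m≤n+m d k)))
              (≤-trans (≤-reflexive (sym (+-suc k (suc (k + d))))) h))
            (trans eq (cong (n ^_) (sym (+-suc (suc k) d))))
    ... | equal   .k   = m , (1 , sym (^-identityʳ m)) , (1 , trans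
            (∣-antisym (^-cancel-∣ (suc k) (∣-reflexive (sym eq))) (^-cancel-∣ (suc k) (∣-reflexive eq)))
            (sym (^-identityʳ m)))
    ... | greater .l d =
            let e , nroot , mroot = commonRoot-step fuel n m l d
                  (≤-trans (+-monoʳ-≤ (suc l) (s≤s (m≤n+m d l)))
                    (≤-trans (≤-reflexive (+-comm (suc l) (suc (l + d)))) h))
                  (trans (sym eq) (cong (m ^_) (sym (+-suc (suc l) d))))
            in e , mroot , nroot

  commonRoot : ∀ m n k l .{{_ : NonZero m}} .{{n≢0 : NonZero n}} .{{_ : NonZero k}} .{{_ : NonZero l}} →
               m ^ k ≡ n ^ l → CommonRoot m n
  commonRoot m n (suc k) (suc l) = commonRoot′ (suc k + suc l) m n k l ≤-refl

  -- A common root `e` has `b = e ^ j`. Here `j = 0` would give `b = 1` and `j ≥ 2` a proper power,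
  -- so `b = e`, and `m` is a power of it. The case `l = 0` is separate because `commonRoot` starts
  -- from positive exponents.
  root-of-^ : ∀ {b m} k l → 2 ≤ b → ¬ ProperPower (+ b) → .{{_ : NonZero m}} .{{_ : NonZero k}} →
              m ^ k ≡ b ^ l → ∃[ j ] m ≡ b ^ j
  root-of-^ {b} {m} k zero 2≤b npp mᵏ≡1 with m^n≡1⇒n≡0∨m≡1 m k mᵏ≡1
  ... | inj₁ k≡0 = contradiction k≡0 (≢-nonZero⁻¹ k)
  ... | inj₂ m≡1 = 0 , m≡1
  root-of-^ {b} {m} k l@(suc _) 2≤b npp eq
    with commonRoot m b k l {{n≢0 = >-nonZero (≤-trans (s≤s z≤n) 2≤b)}} eq
  ... | e , _         , (zero        , b≡1)  = contradiction (subst (2 ≤_) b≡1 2≤b) λ { (s≤s ()) }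
  ... | e , (i , m≡eⁱ) , (suc zero    , b≡e)  = i , trans m≡eⁱ (cong (_^ i) (sym (trans b≡e (*-identityʳ e))))
  ... | e , _         , (suc (suc j) , b≡eʲ) =
    contradiction (+ e , 2 + j , s≤s (s≤s z≤n) , trans (cong +_ b≡eʲ) (pos-^ e (2 + j))) npp

  -- Since `v ^ k` divides `u ^ k`, also `v` divides `u`, and the `k`-th power of the quotient is
  -- `b ^ l`.
  quotient-of-^ : ∀ {b u v} k l → 2 ≤ b → ¬ ProperPower (+ b) →
                  .{{_ : NonZero u}} .{{_ : NonZero v}} .{{_ : NonZero k}} →
                  u ^ k ≡ b ^ l * v ^ k → ∃[ j ] u ≡ b ^ j * v
  quotient-of-^ {b} {u} {v} k l 2≤b npp eq
    with divides q refl ← ^-cancel-∣ {v} {u} k (divides (b ^ l) eq)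
    = let j , q≡bʲ = root-of-^ k l 2≤b npp {{≢-nonZero λ { refl → ≢-nonZero⁻¹ u refl }}}
                     (*-cancelʳ-≡ (q ^ k) (b ^ l) (v ^ k) {{m^n≢0 v k}}
                       (trans (sym (^-distribʳ-* q v k)) eq))
      in j , cong (_* v) q≡bʲ

-- Relative gaps between integers, and closeness that rules them out.

module Gaps where

  open import Data.Nat.Base
  open import Data.Nat.Properties
  open import Data.Nat.Tactic.RingSolver using (solve-∀)
  open import Relation.Binary.Definitions using (tri<; tri≈; tri>)

  ∣-∣-least : ∀ {m n o} → m ≤ n + o → n ≤ m + o → ∣ m - n ∣ ≤ o
  ∣-∣-least {m} {n} m≤n+o n≤m+o with ∣m-n∣≡[m∸n]∨[n∸m] m n
  ... | inj₁ eq = subst (_≤ _) (sym eq) (m≤n+o⇒m∸n≤o m n m≤n+o)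
  ... | inj₂ eq = subst (_≤ _) (sym eq) (m≤n+o⇒m∸n≤o n m n≤m+o)

  -- Integrality gives `y ≥ x + 1`, which for `x ≤ R` is a gap by a factor of at least `1 + 1/R`,
  -- stated without division.
  bounded-gap : ∀ {R x y} → x < y → x ≤ R → R * x + x ≤ R * y
  bounded-gap {R} {x} {y} x<y x≤R = begin
    R * x + x  ≤⟨ +-monoʳ-≤ (R * x) x≤R ⟩
    R * x + R  ≡⟨ trans (+-comm (R * x) R) (sym (*-suc R x)) ⟩
    R * suc x  ≤⟨ *-monoʳ-≤ R x<y ⟩
    R * y      ∎
    where open ≤-Reasoning

  -- Multiples of powers of b with bounded cofactors cannot be close: cancelling
  -- the smaller power leaves a smaller side of at most R.
  power-gap : ∀ {b R} d e {p q} → p ≤ R → q ≤ R → b ^ d * p < b ^ e * q →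
              R * (b ^ d * p) + b ^ d * p ≤ R * (b ^ e * q)
  power-gap {b} {R} d e {p} {q} p≤R q≤R lt = by-cases (≤-total d e)
    where
    split : ∀ d k p → b ^ (d + k) * p ≡ b ^ d * (b ^ k * p)
    split d k p = trans (cong (_* p) (^-distribˡ-+-* b d k)) (*-assoc (b ^ d) (b ^ k) p)

    scaled-gap : ∀ B {x y} → B * x < B * y → (x < y → x ≤ R) → R * (B * x) + B * x ≤ R * (B * y)
    scaled-gap B {x} {y} Bx<By x≤R = begin
      R * (B * x) + B * x  ≡⟨ lemma₁ R B x ⟩
      B * (R * x + x)      ≤⟨ *-monoʳ-≤ B (bounded-gap x<y (x≤R x<y)) ⟩
      B * (R * y)          ≡⟨ lemma₂ B R y ⟩
      R * (B * y)          ∎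
      where
      open ≤-Reasoning
      x<y = *-cancelˡ-< B x y Bx<By
      lemma₁ : ∀ R B x → R * (B * x) + B * x ≡ B * (R * x + x)
      lemma₁ = solve-∀
      lemma₂ : ∀ B R x → B * (R * x) ≡ R * (B * x)
      lemma₂ = solve-∀

    by-cases : d ≤ e ⊎ e ≤ d → R * (b ^ d * p) + b ^ d * p ≤ R * (b ^ e * q)
    by-cases (inj₁ d≤e) with k , refl ← m≤n⇒∃[o]m+o≡n d≤e =
      subst (λ y → R * (b ^ d * p) + b ^ d * p ≤ R * y) (sym (split d k q))
        (scaled-gap (b ^ d) (subst (b ^ d * p <_) (split d k q) lt) (λ _ → p≤R))
    -- Here the smaller side keeps a factor `b ^ k`, but it still lies below `q`, hence below `R`.
    by-cases (inj₂ e≤d) with k , refl ← m≤n⇒∃[o]m+o≡n e≤d =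
      subst (λ x → R * x + x ≤ R * (b ^ e * q)) (sym (split e k p))
        (scaled-gap (b ^ e) (subst (_< b ^ e * q) (split e k p) lt) (λ x<q → ≤-trans (<⇒≤ x<q) q≤R))

  -- Three consecutive values `x`, `y`, `z` of `f` and the corresponding terms `X`, `Y`, `Z` of the
  -- sequence `A`, each known up to `r`. As `x ≥ K`, this error costs only a bounded number of
  -- multiples of `y * y` or `z * x` beside the main term with factor `K`.
  module _ {K r x y z X Y Z : ℕ} .{{_ : NonZero K}}
           (K≤x : K ≤ x) (x≤y : x ≤ y) (y≤z : y ≤ z)
           (close : K * ∣ z * x - y * y ∣ ≤ y * y)
           (rx≤X : r * x ≤ X) (X≤ : X ≤ r * suc x)
           (ry≤Y : r * y ≤ Y) (Y≤ : Y ≤ r * suc y)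
           (rz≤Z : r * z ≤ Z) (Z≤ : Z ≤ r * suc z) where

    private
      open ≤-Reasoning

      1≤z : 1 ≤ z
      1≤z = ≤-trans (>-nonZero⁻¹ K) (≤-trans K≤x (≤-trans x≤y y≤z))

      Kzx≤ : K * (z * x) ≤ K * (y * y) + y * y
      Kzx≤ = begin
        K * (z * x)                                  ≤⟨ *-monoʳ-≤ K (m≤n+∣m-n∣ (z * x) (y * y)) ⟩
        K * (y * y + ∣ z * x - y * y ∣)              ≡⟨ *-distribˡ-+ K (y * y) _ ⟩
        K * (y * y) + K * ∣ z * x - y * y ∣          ≤⟨ +-monoʳ-≤ (K * (y * y)) close ⟩
        K * (y * y) + y * y                          ∎

      Kyy≤ : K * (y * y) ≤ K * (z * x) + y * y
      Kyy≤ = begin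
        K * (y * y)                                  ≤⟨ *-monoʳ-≤ K (m≤n+∣n-m∣ (y * y) (z * x)) ⟩
        K * (z * x + ∣ z * x - y * y ∣)              ≡⟨ *-distribˡ-+ K (z * x) _ ⟩
        K * (z * x) + K * ∣ z * x - y * y ∣          ≤⟨ +-monoʳ-≤ (K * (z * x)) close ⟩
        K * (z * x) + y * y                          ∎

      Kz≤zx : K * z ≤ z * x
      Kz≤zx = subst (_≤ z * x) (*-comm z K) (*-monoʳ-≤ z K≤x)

      Kx≤zx : K * x ≤ z * x
      Kx≤zx = *-monoˡ-≤ x (≤-trans K≤x (≤-trans x≤y y≤z))

      Ky≤zx : K * y ≤ z * x
      Ky≤zx = ≤-trans (*-monoʳ-≤ K y≤z) Kz≤zx

      K≤zx : K ≤ z * x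
      K≤zx = ≤-trans (≤-reflexive (sym (*-identityʳ K))) (≤-trans (*-monoʳ-≤ K 1≤z) Kz≤zx)

      zx≤2yy : z * x ≤ y * y + y * y
      zx≤2yy = *-cancelˡ-≤ K (begin
        K * (z * x)                 ≤⟨ Kzx≤ ⟩
        K * (y * y) + y * y         ≤⟨ +-monoʳ-≤ (K * (y * y)) (m≤n*m (y * y) K) ⟩
        K * (y * y) + K * (y * y)   ≡⟨ *-distribˡ-+ K (y * y) (y * y) ⟨
        K * (y * y + y * y)         ∎)

    -- Besides the main term, which contributes one extra `y * y`, expanding `(z + 1) * (x + 1)`
    -- leaves `K * z`, `K * x` and `K`, each at most `z * x` and so at most `2 * y * y`. The total
    -- is `1 + 2 + 2 + 2 = 7`.
    enlarged-upper : K * (Z * X) ≤ (K + 7) * (Y * Y)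
    enlarged-upper = begin
      K * (Z * X)                                       ≤⟨ *-monoʳ-≤ K (*-mono-≤ Z≤ X≤) ⟩
      K * (r * suc z * (r * suc x))                     ≡⟨ lemma₁ K r z x ⟩
      r * r * (K * (z * x) + K * z + K * x + K)
        ≤⟨ *-monoʳ-≤ (r * r) (+-mono-≤ (+-mono-≤ (+-mono-≤ Kzx≤ (≤-trans Kz≤zx zx≤2yy))
                                (≤-trans Kx≤zx zx≤2yy)) (≤-trans K≤zx zx≤2yy)) ⟩
      r * r * (K * s + s + (s + s) + (s + s) + (s + s)) ≡⟨ lemma₂ K r y ⟩
      (K + 7) * (r * y * (r * y))                       ≤⟨ *-monoʳ-≤ (K + 7) (*-mono-≤ ry≤Y ry≤Y) ⟩
      (K + 7) * (Y * Y)                                 ∎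
      where
      s = y * y
      lemma₁ : ∀ K r z x → K * (r * suc z * (r * suc x)) ≡ r * r * (K * (z * x) + K * z + K * x + K)
      lemma₁ = solve-∀
      lemma₂ : ∀ K r y → r * r * (K * (y * y) + y * y + (y * y + y * y) + (y * y + y * y) + (y * y + y * y))
                         ≡ (K + 7) * (r * y * (r * y))
      lemma₂ = solve-∀

    -- Giving up one of the `K = k + 1` copies of `y * y` absorbs the closeness error, so
    -- `k * y * y ≤ K * z * x`. The terms `k * y`, twice, and `k` add at most `z * x` each, whence
    -- `k + 1 + 3`.
    enlarged-lower : ∀ {k} → K ≡ suc k → k * (Y * Y) ≤ (k + 4) * (Z * X)
    enlarged-lower {k} refl = begin
      k * (Y * Y)                                ≤⟨ *-monoʳ-≤ k (*-mono-≤ Y≤ Y≤) ⟩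
      k * (r * suc y * (r * suc y))              ≡⟨ lemma₁ k r y ⟩
      r * r * (k * (y * y) + k * y + k * y + k)
        ≤⟨ *-monoʳ-≤ (r * r) (+-mono-≤ (+-mono-≤ (+-mono-≤
             (+-cancelˡ-≤ (y * y) _ _ (≤-trans Kyy≤ (≤-reflexive (+-comm (K * (z * x)) (y * y)))))
             (≤-trans (m≤n+m (k * y) y) Ky≤zx)) (≤-trans (m≤n+m (k * y) y) Ky≤zx))
             (≤-trans (n≤1+n k) K≤zx)) ⟩
      r * r * (K * (z * x) + z * x + z * x + z * x) ≡⟨ lemma₂ k r z x ⟩
      (k + 4) * (r * z * (r * x))                ≤⟨ *-monoʳ-≤ (k + 4) (*-mono-≤ rz≤Z rx≤X) ⟩
      (k + 4) * (Z * X)                          ∎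
      where
      lemma₁ : ∀ k r y → k * (r * suc y * (r * suc y)) ≡ r * r * (k * (y * y) + k * y + k * y + k)
      lemma₁ = solve-∀
      lemma₂ : ∀ k r z x → r * r * (suc k * (z * x) + z * x + z * x + z * x) ≡ (k + 4) * (r * z * (r * x))
      lemma₂ = solve-∀

  -- The last two hypotheses have the form of `enlarged-lower` and `enlarged-upper` at
  -- `K = 8 R + 1`. A gap by the factor `1 + 1/R` in either direction exceeds what they allow:
  -- multiplied by 8, it leaves `4 X ≤ 0` or `X ≤ 0`.
  no-gap⇒≡ : ∀ {R X Y} .{{_ : NonZero X}} →
             (X < Y → R * X + X ≤ R * Y) → (Y < X → R * Y + Y ≤ R * X) →
             8 * R * Y ≤ (8 * R + 4) * X → suc (8 * R) * X ≤ (suc (8 * R) + 7) * Y → X ≡ Y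
  no-gap⇒≡ {R} {X} {Y} gap₁ gap₂ lower upper with <-cmp X Y
  ... | tri≈ _ X≡Y _ = X≡Y
  ... | tri< X<Y _ _ = contradiction (+-cancelˡ-≤ ((8 * R + 4) * X) _ 0 (begin
          (8 * R + 4) * X + 4 * X    ≡⟨ lemma R X ⟩
          8 * (R * X + X)            ≤⟨ *-monoʳ-≤ 8 (gap₁ X<Y) ⟩
          8 * (R * Y)                ≡⟨ *-assoc 8 R Y ⟨
          8 * R * Y                  ≤⟨ lower ⟩
          (8 * R + 4) * X            ≡⟨ +-identityʳ _ ⟨
          (8 * R + 4) * X + 0        ∎))
          (<⇒≱ (≤-trans (>-nonZero⁻¹ X) (m≤n*m X 4)))
    where
    open ≤-Reasoning
    lemma : ∀ R X → (8 * R + 4) * X + 4 * X ≡ 8 * (R * X + X)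
    lemma = solve-∀
  ... | tri> _ _ Y<X = contradiction (+-cancelˡ-≤ (8 * (R * X)) _ 0 (begin
          8 * (R * X) + X            ≡⟨ lemma₁ R X ⟩
          suc (8 * R) * X            ≤⟨ upper ⟩
          (suc (8 * R) + 7) * Y      ≡⟨ lemma₂ R Y ⟩
          8 * (R * Y + Y)            ≤⟨ *-monoʳ-≤ 8 (gap₂ Y<X) ⟩
          8 * (R * X)                ≡⟨ +-identityʳ _ ⟨
          8 * (R * X) + 0            ∎))
          (<⇒≱ (>-nonZero⁻¹ X))
    where
    open ≤-Reasoning
    lemma₁ : ∀ R X → 8 * (R * X) + X ≡ suc (8 * R) * X
    lemma₁ = solve-∀
    lemma₂ : ∀ R Y → (suc (8 * R) + 7) * Y ≡ 8 * (R * Y + Y)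
    lemma₂ = solve-∀

-- Geometric sequences, and the growth of `f` derived from the remainders.

module Recurrence where

  open import Data.Fin.Base using (toℕ; fromℕ<)
  open import Data.Fin.Properties using (pigeonhole; toℕ-fromℕ<)
  import Data.Integer.Base as ℤ
  open import Data.Nat.Base
  open import Data.Nat.Properties
  open import Data.Nat.Tactic.RingSolver using (solve-∀)
  open import Defs using (ProperPower)
  open Powers using (quotient-of-^)
  open Gaps

  no-descent : ∀ (A : ℕ → ℕ) → ¬ (∀ i → A (suc i) < A i)
  no-descent A desc = <⇒≱ (s≤s (m≤n+m (A 0) (A (suc (A 0))))) (≤-trans
      (≤-reflexive (sym (+-suc (A (suc (A 0))) (A 0)))) (below (suc (A 0))))
    where
    open ≤-Reasoning
    below : ∀ i → A i + i ≤ A 0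
    below zero    = ≤-reflexive (+-identityʳ (A 0))
    below (suc i) = begin
      A (suc i) + suc i    ≡⟨ +-suc (A (suc i)) i ⟩
      suc (A (suc i)) + i  ≤⟨ +-monoˡ-≤ i (desc i) ⟩
      A i + i              ≤⟨ below i ⟩
      A 0                  ∎

  module Geometric (A : ℕ → ℕ) (A≢0 : ∀ i → NonZero (A i))
                   (log-affine : ∀ i → A (2 + i) * A i ≡ A (suc i) * A (suc i)) where

    private
      instance
        Ai≢0 : ∀ {i} → NonZero (A i)
        Ai≢0 {i} = A≢0 i

    -- The ratio of neighbours is always that of the first two terms, cross-multiplied to stay
    -- within the naturals.
    ratio : ∀ i → A (suc i) * A 0 ≡ A i * A 1
    ratio zero    = *-comm (A 1) (A 0)
    ratio (suc i) = *-cancelˡ-≡ _ _ (A i) (begin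
      A i * (A (2 + i) * A 0)          ≡⟨ lemma₁ (A i) (A (2 + i)) (A 0) ⟩
      A (2 + i) * A i * A 0            ≡⟨ cong (_* A 0) (log-affine i) ⟩
      A (suc i) * A (suc i) * A 0      ≡⟨ *-assoc (A (suc i)) (A (suc i)) (A 0) ⟩
      A (suc i) * (A (suc i) * A 0)    ≡⟨ cong (A (suc i) *_) (ratio i) ⟩
      A (suc i) * (A i * A 1)          ≡⟨ lemma₂ (A (suc i)) (A i) (A 1) ⟩
      A i * (A (suc i) * A 1)          ∎)
      where
      open ≡-Reasoning
      lemma₁ : ∀ x y z → x * (y * z) ≡ y * x * z
      lemma₁ = solve-∀
      lemma₂ : ∀ x y z → x * (y * z) ≡ y * (x * z)
      lemma₂ = solve-∀

    ratio-^ : ∀ k i → A (k + i) * A 0 ^ k ≡ A i * A 1 ^ k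
    ratio-^ zero    i = refl
    ratio-^ (suc k) i = begin
      A (suc k + i) * (A 0 * A 0 ^ k)  ≡⟨ *-assoc (A (suc k + i)) (A 0) (A 0 ^ k) ⟨
      A (suc k + i) * A 0 * A 0 ^ k    ≡⟨ cong (_* A 0 ^ k) (ratio (k + i)) ⟩
      A (k + i) * A 1 * A 0 ^ k        ≡⟨ lemma (A (k + i)) (A 1) (A 0 ^ k) ⟩
      A 1 * (A (k + i) * A 0 ^ k)      ≡⟨ cong (A 1 *_) (ratio-^ k i) ⟩
      A 1 * (A i * A 1 ^ k)            ≡⟨ lemma′ (A 1) (A i) (A 1 ^ k) ⟩
      A i * (A 1 * A 1 ^ k)            ∎
      where
      open ≡-Reasoning
      lemma : ∀ x y z → x * y * z ≡ y * (x * z)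
      lemma = solve-∀
      lemma′ : ∀ x y z → x * (y * z) ≡ y * (x * z)
      lemma′ = solve-∀

    -- A ratio below 1 would make `A` decrease strictly for ever.
    A₀≤A₁ : A 0 ≤ A 1
    A₀≤A₁ with A 0 ≤? A 1
    ... | yes p = p
    ... | no  p = contradiction (λ i → *-cancelʳ-< (A 0) (A (suc i)) (A i)
                    (subst (_< A i * A 0) (sym (ratio i)) (*-monoʳ-< (A i) (≰⇒> p)))) (no-descent A)

    -- Two terms with the same cofactor differ by a power of b, and the ratio of
    -- the sequence is a root of that power.
    ratio-is-power : ∀ {b r} (L T : ℕ → ℕ) → 2 ≤ b → ¬ ProperPower (ℤ.+ b) →
                     (∀ i → A i ≡ b ^ L i * T i) → (∀ i → T i ≤ r) →
                     ∃[ j ] ∀ i → A (suc i) ≡ b ^ j * A i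
    ratio-is-power {b} {r} L T 2≤b npp A≡ T≤r
      -- The `r + 2` indices `0, …, r + 1` outnumber the `r + 1` possible values of `T`.
      with i′ , j′ , i<j , eq ← pigeonhole (n<1+n (suc r)) (λ i → fromℕ< (s≤s (T≤r (toℕ i))))
      with k , i+k≡j ← m≤n⇒∃[o]m+o≡n i<j
      = proj₁ A₁≡ , λ n → *-cancelʳ-≡ _ _ (A 0) (begin
          A (suc n) * A 0                  ≡⟨ ratio n ⟩
          A n * A 1                        ≡⟨ cong (A n *_) (proj₂ A₁≡) ⟩
          A n * (b ^ proj₁ A₁≡ * A 0)      ≡⟨ lemma (A n) (b ^ proj₁ A₁≡) (A 0) ⟩
          b ^ proj₁ A₁≡ * A n * A 0        ∎)
      where
      open ≡-Reasoning
      instance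
        b≢0 : NonZero b
        b≢0 = >-nonZero (≤-trans (s≤s z≤n) 2≤b)
      i = toℕ i′
      j = toℕ j′
      lemma : ∀ x y z → x * (y * z) ≡ y * x * z
      lemma = solve-∀
      j≡k+i : j ≡ suc k + i
      j≡k+i = trans (sym i+k≡j) (cong suc (+-comm i k))
      T≡ : T i ≡ T j
      T≡ = trans (sym (toℕ-fromℕ< _)) (trans (cong toℕ eq) (toℕ-fromℕ< _))
      Ti≢0 : NonZero (T i)
      Ti≢0 = ≢-nonZero λ Ti≡0 → ≢-nonZero⁻¹ (A i)
        (trans (A≡ i) (trans (cong (b ^ L i *_) Ti≡0) (*-zeroʳ (b ^ L i))))
      -- The quotient `A j / A i` is the power `k + 1` of the ratio `A 1 / A 0` and, the cofactors
      -- being equal, also `b ^ L j / b ^ L i`.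
      Lj : b ^ L j * A 0 ^ suc k ≡ b ^ L i * A 1 ^ suc k
      Lj = *-cancelʳ-≡ _ _ (T i) {{Ti≢0}} (begin
        b ^ L j * A 0 ^ suc k * T i        ≡⟨ lemma₁ (b ^ L j) (A 0 ^ suc k) (T i) ⟩
        b ^ L j * T i * A 0 ^ suc k        ≡⟨ cong (λ t → b ^ L j * t * A 0 ^ suc k) T≡ ⟩
        b ^ L j * T j * A 0 ^ suc k        ≡⟨ cong (_* A 0 ^ suc k) (A≡ j) ⟨
        A j * A 0 ^ suc k                  ≡⟨ cong (λ t → A t * A 0 ^ suc k) j≡k+i ⟩
        A (suc k + i) * A 0 ^ suc k        ≡⟨ ratio-^ (suc k) i ⟩
        A i * A 1 ^ suc k                  ≡⟨ cong (_* A 1 ^ suc k) (A≡ i) ⟩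
        b ^ L i * T i * A 1 ^ suc k        ≡⟨ lemma₁ (b ^ L i) (T i) (A 1 ^ suc k) ⟩
        b ^ L i * A 1 ^ suc k * T i        ∎)
        where
        lemma₁ : ∀ x y z → x * y * z ≡ x * z * y
        lemma₁ = solve-∀
      -- This makes the truncated difference `L j ∸ L i` exact: if `L j < L i`, then `A 0 ≤ A 1`
      -- would make the left side of `Lj` the smaller one.
      Li≤Lj : L i ≤ L j
      Li≤Lj with L i ≤? L j
      ... | yes p = p
      ... | no  p = contradiction Lj (<⇒≢ (<-≤-trans
        (*-monoˡ-< (A 0 ^ suc k) {{m^n≢0 (A 0) (suc k)}} (^-monoʳ-< b 2≤b (≰⇒> p)))
        (*-monoʳ-≤ (b ^ L i) (^-monoˡ-≤ (suc k) A₀≤A₁))))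
      A₁≡ : ∃[ j ] A 1 ≡ b ^ j * A 0
      A₁≡ = quotient-of-^ (suc k) (L j ∸ L i) 2≤b npp
        (*-cancelˡ-≡ _ _ (b ^ L i) {{m^n≢0 b (L i)}} (trans (sym Lj) (begin
          b ^ L j * A 0 ^ suc k                      ≡⟨ cong (λ l → b ^ l * A 0 ^ suc k) (m+[n∸m]≡n Li≤Lj) ⟨
          b ^ (L i + (L j ∸ L i)) * A 0 ^ suc k      ≡⟨ cong (_* A 0 ^ suc k) (^-distribˡ-+-* b (L i) (L j ∸ L i)) ⟩
          b ^ L i * b ^ (L j ∸ L i) * A 0 ^ suc k    ≡⟨ *-assoc (b ^ L i) (b ^ (L j ∸ L i)) (A 0 ^ suc k) ⟩
          b ^ L i * (b ^ (L j ∸ L i) * A 0 ^ suc k)  ∎)))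

  -- The first component becomes the bounded error term, the second the convergence of
  -- `F (suc n) / F n` to `a`. When `F` is bounded, the second says more than the first.
  NearlyGeometric : (ℕ → ℕ) → ℕ → Set
  NearlyGeometric F a =
    (∃[ N ] ∀ n → N ≤ n → ∣ F (suc n) - a * F n ∣ ≤ a) ×
    (∀ K → ∃[ N ] ∀ n → N ≤ n → K * ∣ F (suc n) - a * F n ∣ ≤ F n)

  -- The quotient of two consecutive ratios tends to 1, with denominators cleared. Convergence of
  -- the ratios themselves is not asserted.
  RatiosConverge : (ℕ → ℕ) → Set
  RatiosConverge F =
    ∀ K → ∃[ N ] ∀ n → N ≤ n → K * ∣ F (2 + n) * F n - F (suc n) * F (suc n) ∣ ≤ F (suc n) * F (suc n)

  module Growth {b r : ℕ} (2≤b : 2 ≤ b) (npp : ¬ ProperPower (ℤ.+ b)) (r≢0 : NonZero r)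
              (F L T : ℕ → ℕ) (F≢0 : ∀ n → NonZero (F n)) (F-step : ∀ n → F n ≤ F (suc n))
              (converge : RatiosConverge F)
              (T≤r : ∀ n → T n ≤ r) (T-step : ∀ n → b ^ L n * T n ≡ r * F n + T (suc n)) where

    private
      -- `R` bounds the product of two remainders, the cofactor in a product of two terms of `A`.
      -- `K` is the precision for which `no-gap⇒≡` is made.
      R = r * r
      K = suc (8 * R)

      A : ℕ → ℕ
      A n = b ^ L n * T n

      instance
        _ : NonZero r
        _ = r≢0
        b≢0 : NonZero b
        b≢0 = >-nonZero (≤-trans (s≤s z≤n) 2≤b)
        Fn≢0 : ∀ {n} → NonZero (F n)
        Fn≢0 {n} = F≢0 n

      A≥rF : ∀ n → r * F n ≤ A n
      A≥rF n = subst (r * F n ≤_) (sym (T-step n)) (m≤m+n (r * F n) (T (suc n)))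

      A≤rF+r : ∀ n → A n ≤ r * suc (F n)
      A≤rF+r n = begin
        A n                  ≡⟨ T-step n ⟩
        r * F n + T (suc n)  ≤⟨ +-monoʳ-≤ (r * F n) (T≤r (suc n)) ⟩
        r * F n + r          ≡⟨ trans (+-comm (r * F n) r) (sym (*-suc r (F n))) ⟩
        r * suc (F n)        ∎
        where open ≤-Reasoning

      A≢0 : ∀ n → NonZero (A n)
      A≢0 n = >-nonZero (≤-trans (>-nonZero⁻¹ (r * F n) {{m*n≢0 r (F n)}}) (A≥rF n))

      T>0 : ∀ n → 0 < T n
      T>0 n = n≢0⇒n>0 λ Tn≡0 → ≢-nonZero⁻¹ (A n) {{A≢0 n}}
        (trans (cong (b ^ L n *_) Tn≡0) (*-zeroʳ (b ^ L n)))

      -- Both sides are a power of `b` times a cofactor of at most `R`, so they are equal or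
      -- separated by `power-gap`. The closeness of the ratios of `F`, carried over to `A`, excludes
      -- the gap.
      log-affine : ∀ n → K ≤ F n →
                   K * ∣ F (2 + n) * F n - F (suc n) * F (suc n) ∣ ≤ F (suc n) * F (suc n) →
                   A (2 + n) * A n ≡ A (suc n) * A (suc n)
      log-affine n K≤F close = no-gap⇒≡ {R} {{m*n≢0 (A (2 + n)) (A n) {{A≢0 (2 + n)}} {{A≢0 n}}}}
        (λ lt → subst₂ _≤_ (cong (λ x → R * x + x) (sym (split (2 + n) n)))
                           (cong (R *_) (sym (split (suc n) (suc n))))
                  (power-gap {b} {R} (L (2 + n) + L n) (L (suc n) + L (suc n)) T≤R T≤R
                    (subst₂ _<_ (split (2 + n) n) (split (suc n) (suc n)) lt)))
        (λ lt → subst₂ _≤_ (cong (λ x → R * x + x) (sym (split (suc n) (suc n))))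
                           (cong (R *_) (sym (split (2 + n) n)))
                  (power-gap {b} {R} (L (suc n) + L (suc n)) (L (2 + n) + L n) T≤R T≤R
                    (subst₂ _<_ (split (suc n) (suc n)) (split (2 + n) n) lt)))
        (enlarged-lower {K} {r} {F n} {F (suc n)} {F (2 + n)} K≤F (F-step n) (F-step (suc n)) close
          (A≥rF n) (A≤rF+r n) (A≥rF (suc n)) (A≤rF+r (suc n)) (A≥rF (2 + n)) (A≤rF+r (2 + n)) refl)
        (enlarged-upper {K} {r} {F n} {F (suc n)} {F (2 + n)} K≤F (F-step n) (F-step (suc n)) close
          (A≥rF n) (A≤rF+r n) (A≥rF (suc n)) (A≤rF+r (suc n)) (A≥rF (2 + n)) (A≤rF+r (2 + n)))
        where
        split : ∀ m n → A m * A n ≡ b ^ (L m + L n) * (T m * T n)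
        split m n = trans ([m*n]*[o*p]≡[m*o]*[n*p] (b ^ L m) (T m) (b ^ L n) (T n))
          (cong (_* (T m * T n)) (sym (^-distribˡ-+-* b (L m) (L n))))
        T≤R : ∀ {m n} → T m * T n ≤ R
        T≤R {m} {n} = *-mono-≤ (T≤r m) (T≤r n)

      F-mono : ∀ m k → F m ≤ F (k + m)
      F-mono m zero    = ≤-refl
      F-mono m (suc k) = ≤-trans (F-mono m k) (F-step (k + m))

      module _ {N : ℕ} (close : ∀ n → N ≤ n →
               K * ∣ F (2 + n) * F n - F (suc n) * F (suc n) ∣ ≤ F (suc n) * F (suc n)) where

        -- Cancelling `F n` from the closeness bounds `K` times the next increment by `F n < K`, so
        -- the increment is an integer below 1.
        stays-equal : ∀ n → N ≤ n → F n < K → F (suc n) ≡ F n → F (2 + n) ≡ F (suc n)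
        stays-equal n N≤n F<K eq = trans (∣m-n∣≡0⇒m≡n (n≤0⇒n≡0 (s≤s⁻¹ (*-cancelˡ-< K ∣ F (2 + n) - F n ∣ 1 (begin-strict
          K * ∣ F (2 + n) - F n ∣   ≤⟨ *-cancelʳ-≤ (K * ∣ F (2 + n) - F n ∣) (F n) (F n) (begin
              K * ∣ F (2 + n) - F n ∣ * F n            ≡⟨ *-assoc K ∣ F (2 + n) - F n ∣ (F n) ⟩
              K * (∣ F (2 + n) - F n ∣ * F n)          ≡⟨ cong (K *_) (*-distribʳ-∣-∣ (F n) (F (2 + n)) (F n)) ⟩
              K * ∣ F (2 + n) * F n - F n * F n ∣      ≤⟨ subst (λ x → K * ∣ F (2 + n) * F n - x * x ∣ ≤ x * x) eq (close n N≤n) ⟩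
              F n * F n                                ∎) ⟩
          F n                       <⟨ F<K ⟩
          K                         ≡⟨ *-identityʳ K ⟨
          K * 1                     ∎))))) (sym eq)
          where open ≤-Reasoning

        constant-from : ∀ n → N ≤ n → F n < K → F (suc n) ≡ F n → ∀ k → F (suc k + n) ≡ F (k + n) × F (k + n) < K
        constant-from n N≤n F<K eq zero    = eq , F<K
        constant-from n N≤n F<K eq (suc k) =
          let eq′ , F<K′ = constant-from n N≤n F<K eq k
          in stays-equal (k + n) (≤-trans N≤n (m≤n+m n k)) F<K′ eq′ , subst (_< K) (sym eq′) F<K′

        -- Below `K`, a step that repeats the value repeats it for ever, and any other step raises
        -- `F` by at least 1. Hence `K` steps of search suffice.
        large-or-constant : ∃[ M ] N ≤ M × (K ≤ F M ⊎ (∀ k → F (suc k + M) ≡ F (k + M)))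
        large-or-constant = search K N ≤-refl (m≤n+m K (F N))
          where
          search : ∀ fuel n → N ≤ n → K ≤ F n + fuel →
                   ∃[ M ] N ≤ M × (K ≤ F M ⊎ (∀ k → F (suc k + M) ≡ F (k + M)))
          search zero       n N≤n h = n , N≤n , inj₁ (subst (K ≤_) (+-identityʳ (F n)) h)
          search (suc fuel) n N≤n h with K ≤? F n | F (suc n) ≟ F n
          ... | yes K≤F | _      = n , N≤n , inj₁ K≤F
          ... | no  K≰F | yes eq = n , N≤n , inj₂ λ k → proj₁ (constant-from n N≤n (≰⇒> K≰F) eq k)
          ... | no  _   | no neq = search fuel (suc n) (m≤n⇒m≤1+n N≤n) (≤-trans h (≤-trans
                (≤-reflexive (+-suc (F n) fuel)) (+-monoˡ-≤ fuel (≤∧≢⇒< (F-step n) (≢-sym neq)))))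

      constant⇒nearlyGeometric : ∀ M → (∀ k → F (suc k + M) ≡ F (k + M)) → NearlyGeometric F 1
      constant⇒nearlyGeometric M const =
        (M , λ n M≤n → ≤-trans (≤-reflexive (vanishes n M≤n)) z≤n) ,
        λ K → M , λ n M≤n → ≤-trans (≤-reflexive (trans (cong (K *_) (vanishes n M≤n)) (*-zeroʳ K))) z≤n
        where
        vanishes : ∀ n → M ≤ n → ∣ F (suc n) - 1 * F n ∣ ≡ 0
        vanishes n M≤n with k , refl ← m≤n⇒∃[o]m+o≡n M≤n =
          m≡n⇒∣m-n∣≡0 (trans (subst (λ m → F (suc m) ≡ F m) (+-comm k M) (const k)) (sym (*-identityˡ _)))

      -- As the remainders lie between 1 and `r`, the value `F n` is the only integer `v` with
      -- `r * v < A n ≤ r * (v + 1)`.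
      A-determines-F : ∀ {m n} → A m ≡ A n → F m ≤ F n
      A-determines-F {m} {n} eq = s≤s⁻¹ (*-cancelˡ-< r (F m) (suc (F n)) (begin-strict
        r * F m              <⟨ m<m+n (r * F m) (T>0 (suc m)) ⟩
        r * F m + T (suc m)  ≡⟨ T-step m ⟨
        A m                  ≡⟨ eq ⟩
        A n                  ≤⟨ A≤rF+r n ⟩
        r * suc (F n)        ∎))
        where open ≤-Reasoning

      module _ {a M : ℕ} .{{_ : NonZero a}} (A-ratio : ∀ k → A (suc k + M) ≡ a * A (k + M)) where

        -- Both bounds come from `A (suc n) = a * A n` and `r * F ≤ A ≤ r * (F + 1)` after division
        -- by `r`.
        difference≤a : ∀ k → ∣ F (suc k + M) - a * F (k + M) ∣ ≤ a
        difference≤a k = ∣-∣-least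
          (*-cancelˡ-≤ r (begin
            r * F (suc n)            ≤⟨ A≥rF (suc n) ⟩
            A (suc n)                ≡⟨ A-ratio k ⟩
            a * A n                  ≤⟨ *-monoʳ-≤ a (A≤rF+r n) ⟩
            a * (r * suc (F n))      ≡⟨ lemma₁ a r (F n) ⟩
            r * (a * F n + a)        ∎))
          (*-cancelˡ-≤ r (begin
            r * (a * F n)            ≡⟨ lemma₂ a r (F n) ⟩
            a * (r * F n)            ≤⟨ *-monoʳ-≤ a (A≥rF n) ⟩
            a * A n                  ≡⟨ A-ratio k ⟨
            A (suc n)                ≤⟨ A≤rF+r (suc n) ⟩
            r * suc (F (suc n))      ≡⟨ cong (r *_) (+-comm 1 (F (suc n))) ⟩
            r * (F (suc n) + 1)      ≤⟨ *-monoʳ-≤ r (+-monoʳ-≤ (F (suc n)) (>-nonZero⁻¹ a)) ⟩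
            r * (F (suc n) + a)      ∎))
          where
          open ≤-Reasoning
          n = k + M
          lemma₁ : ∀ a r f → a * (r * suc f) ≡ r * (a * f + a)
          lemma₁ = solve-∀
          lemma₂ : ∀ a r f → r * (a * f) ≡ a * (r * f)
          lemma₂ = solve-∀

        module _ (2≤a : 2 ≤ a) where

          A-grows : ∀ k → k ≤ A (k + M)
          A-grows zero    = z≤n
          A-grows (suc k) = begin
            1 + k                       ≤⟨ +-mono-≤ (>-nonZero⁻¹ (A (k + M)) {{A≢0 (k + M)}}) (A-grows k) ⟩
            A (k + M) + A (k + M)       ≡⟨ cong (A (k + M) +_) (+-identityʳ _) ⟨
            2 * A (k + M)               ≤⟨ *-monoˡ-≤ (A (k + M)) 2≤a ⟩
            a * A (k + M)               ≡⟨ A-ratio k ⟨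
            A (suc k + M)               ∎
            where open ≤-Reasoning

          F-grows : ∀ K k → r * suc K ≤ k → K ≤ F (k + M)
          F-grows K k h = s≤s⁻¹ (*-cancelˡ-≤ r (≤-trans h (≤-trans (A-grows k) (A≤rF+r (k + M)))))

          growing⇒nearlyGeometric : NearlyGeometric F a
          growing⇒nearlyGeometric =
            (M , λ n M≤n → shifted (λ n → ∣ F (suc n) - a * F n ∣ ≤ a) M difference≤a n M≤n) ,
            -- After this many further steps `F` is at least `K * a`, so that an error of at most
            -- `a` is at most the fraction `1/K` of it.
            λ K → r * suc (K * a) + M , shifted _ (r * suc (K * a) + M) λ k →
              ≤-trans
                (*-monoʳ-≤ K (subst (λ n → ∣ F (suc n) - a * F n ∣ ≤ a) (+-assoc k _ M) (difference≤a (k + r * suc (K * a)))))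
                (subst (λ n → K * a ≤ F n) (+-assoc k _ M) (F-grows (K * a) (k + r * suc (K * a)) (m≤n+m _ k)))
            where
            shifted : ∀ (P : ℕ → Set) M → (∀ k → P (k + M)) → ∀ n → M ≤ n → P n
            shifted P M h n M≤n with k , refl ← m≤n⇒∃[o]m+o≡n M≤n = subst P (+-comm k M) (h k)

      -- With ratio 1 nothing grows, but then `A` is constant and determines `F`. Any other power of
      -- `b` is at least 2, and the bounded error becomes negligible.
      ratio⇒nearlyGeometric : ∀ {M} → ∃[ j ] (∀ k → A (suc k + M) ≡ b ^ j * A (k + M)) →
                              ∃[ j ] NearlyGeometric F (b ^ j)
      ratio⇒nearlyGeometric {M} (zero  , A-ratio) = 0 , constant⇒nearlyGeometric M λ k → ≤-antisym
        (A-determines-F (trans (A-ratio k) (+-identityʳ (A (k + M))))) (F-step (k + M))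
      ratio⇒nearlyGeometric {M} (suc j , A-ratio) = suc j ,
        growing⇒nearlyGeometric {{m^n≢0 b (suc j)}} A-ratio
          (≤-trans 2≤b (m≤m*n b (b ^ j) {{m^n≢0 b j}}))

    nearlyGeometric : ∃[ j ] NearlyGeometric F (b ^ j)
    nearlyGeometric = split (large-or-constant close)
      where
      N = proj₁ (converge K)
      close = proj₂ (converge K)
      split : ∃[ M ] N ≤ M × (K ≤ F M ⊎ (∀ k → F (suc k + M) ≡ F (k + M))) →
              ∃[ j ] NearlyGeometric F (b ^ j)
      split (M , N≤M , inj₂ const) = 0 , constant⇒nearlyGeometric M const
      split (M , N≤M , inj₁ K≤F)   = ratio⇒nearlyGeometric
        (Geometric.ratio-is-power (λ i → A (i + M)) (λ i → A≢0 (i + M))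
           (λ i → log-affine (i + M) (≤-trans K≤F (F-mono M i)) (close (i + M) (≤-trans N≤M (m≤n+m M i))))
           (λ i → L (i + M)) (λ i → T (i + M)) 2≤b npp (λ i → refl) (λ i → T≤r (i + M)))

-- Rational estimates for quotients close to 1.

module Rationals where

  open import Data.Integer.Base as ℤ using (+_)
  import Data.Integer.Properties as ℤ
  import Data.Nat.Properties as ℕ
  open import Data.Rational.Base
  open import Data.Rational.Properties
  open import Data.Rational.Solver using (module +-*-Solver)
  import Data.Rational.Unnormalised.Base as ℚᵘ
  import Data.Rational.Unnormalised.Properties as ℚᵘ
  open +-*-Solver

  ι : ℕ → ℚ
  ι n = + n / 1

  ι≃ : ∀ n → toℚᵘ (ι n) ℚᵘ.≃ ℚᵘ.mkℚᵘ (+ n) 0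
  ι≃ n = toℚᵘ-fromℚᵘ (ℚᵘ.mkℚᵘ (+ n) 0)

  ι-mono-≤ : ∀ {m n} → m ℕ.≤ n → ι m ≤ ι n
  ι-mono-≤ {m} {n} m≤n = toℚᵘ-cancel-≤
    (ℚᵘ.≤-respˡ-≃ (ℚᵘ.≃-sym (ι≃ m)) (ℚᵘ.≤-respʳ-≃ (ℚᵘ.≃-sym (ι≃ n))
      (ℚᵘ.*≤* (ℤ.*-monoʳ-≤-nonNeg (+ 1) (ℤ.+≤+ m≤n)))))

  ι-mono-< : ∀ {m n} → m ℕ.< n → ι m < ι n
  ι-mono-< {m} {n} m<n = toℚᵘ-cancel-<
    (ℚᵘ.<-respˡ-≃ (ℚᵘ.≃-sym (ι≃ m)) (ℚᵘ.<-respʳ-≃ (ℚᵘ.≃-sym (ι≃ n))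
      (ℚᵘ.*<* (ℤ.*-monoʳ-<-pos (+ 1) (ℤ.+<+ m<n)))))

  ι-cancel-≤ : ∀ {m n} → ι m ≤ ι n → m ℕ.≤ n
  ι-cancel-≤ {m} {n} ιm≤ιn with ℕ.≤-total m n
  ... | inj₁ m≤n = m≤n
  ... | inj₂ n≤m with ℕ.m≤n⇒m<n∨m≡n n≤m
  ...   | inj₁ n<m = contradiction (<-≤-trans (ι-mono-< n<m) ιm≤ιn) (<-irrefl refl)
  ...   | inj₂ n≡m = ℕ.≤-reflexive (sym n≡m)

  0≤ι : ∀ n → 0ℚ ≤ ι n
  0≤ι n = ι-mono-≤ {0} {n} ℕ.z≤n

  ι-pos : ∀ n .{{_ : ℕ.NonZero n}} → Positive (ι n)
  ι-pos n = positive (ι-mono-< {0} {n} (ℕ.>-nonZero⁻¹ n))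

  ι-+ : ∀ m n → ι (m ℕ.+ n) ≡ ι m + ι n
  ι-+ m n = toℚᵘ-injective (begin
    toℚᵘ (ι (m ℕ.+ n))                      ≈⟨ ι≃ (m ℕ.+ n) ⟩
    ℚᵘ.mkℚᵘ (+ (m ℕ.+ n)) 0                 ≈⟨ ℚᵘ.*≡* (cong (ℤ._* + 1) (trans (ℤ.pos-+ m n)
                                                 (sym (cong₂ ℤ._+_ (ℤ.*-identityʳ (+ m)) (ℤ.*-identityʳ (+ n)))))) ⟩
    ℚᵘ.mkℚᵘ (+ m) 0 ℚᵘ.+ ℚᵘ.mkℚᵘ (+ n) 0    ≈⟨ ℚᵘ.+-cong (ι≃ m) (ι≃ n) ⟨
    toℚᵘ (ι m) ℚᵘ.+ toℚᵘ (ι n)              ≈⟨ toℚᵘ-homo-+ (ι m) (ι n) ⟨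
    toℚᵘ (ι m + ι n)                        ∎)
    where open ℚᵘ.≃-Reasoning

  ι-* : ∀ m n → ι (m ℕ.* n) ≡ ι m * ι n
  ι-* m n = toℚᵘ-injective (begin
    toℚᵘ (ι (m ℕ.* n))                      ≈⟨ ι≃ (m ℕ.* n) ⟩
    ℚᵘ.mkℚᵘ (+ (m ℕ.* n)) 0                 ≈⟨ ℚᵘ.*≡* (cong (ℤ._* + 1) (ℤ.pos-* m n)) ⟩
    ℚᵘ.mkℚᵘ (+ m) 0 ℚᵘ.* ℚᵘ.mkℚᵘ (+ n) 0    ≈⟨ ℚᵘ.*-cong (ι≃ m) (ι≃ n) ⟨
    toℚᵘ (ι m) ℚᵘ.* toℚᵘ (ι n)              ≈⟨ toℚᵘ-homo-* (ι m) (ι n) ⟨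
    toℚᵘ (ι m * ι n)                        ∎)
    where open ℚᵘ.≃-Reasoning

  ι-/ : ∀ m n .{{_ : ℕ.NonZero n}} → (+ m / n) * ι n ≡ ι m
  ι-/ m n@(suc k) = toℚᵘ-injective (begin
    toℚᵘ ((+ m / n) * ι n)                 ≈⟨ toℚᵘ-homo-* (+ m / n) (ι n) ⟩
    toℚᵘ (+ m / n) ℚᵘ.* toℚᵘ (ι n)         ≈⟨ ℚᵘ.*-cong (toℚᵘ-fromℚᵘ (ℚᵘ.mkℚᵘ (+ m) k)) (ι≃ n) ⟩
    ℚᵘ.mkℚᵘ (+ m) k ℚᵘ.* ℚᵘ.mkℚᵘ (+ n) 0   ≈⟨ ℚᵘ.*≡* (trans (ℤ.*-identityʳ (+ m ℤ.* + n))
                                                (cong (+ m ℤ.*_) (cong +_ (sym (ℕ.*-identityʳ n))))) ⟩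
    ℚᵘ.mkℚᵘ (+ m) 0                        ≈⟨ ι≃ m ⟨
    toℚᵘ (ι m)                             ∎)
    where open ℚᵘ.≃-Reasoning

  p≤∣p∣ : ∀ p → p ≤ ∣ p ∣
  p≤∣p∣ p with ≤-total 0ℚ p
  ... | inj₁ 0≤p = ≤-reflexive (sym (0≤p⇒∣p∣≡p 0≤p))
  ... | inj₂ p≤0 = ≤-trans p≤0 (0≤∣p∣ p)

  ∣-∣-comm : ∀ p q → ∣ p - q ∣ ≡ ∣ q - p ∣
  ∣-∣-comm p q = trans (sym (∣-p∣≡∣p∣ (p - q)))
    (cong ∣_∣ (solve 2 (λ p q → :- (p :- q) := q :- p) refl p q))

  ∣cp∣≡c∣p∣ : ∀ {c} → 0ℚ ≤ c → ∀ p → ∣ c * p ∣ ≡ c * ∣ p ∣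
  ∣cp∣≡c∣p∣ {c} 0≤c p = trans (∣p*q∣≡∣p∣*∣q∣ c p) (cong (_* ∣ p ∣) (0≤p⇒∣p∣≡p 0≤c))

  ι-∣-∣ : ∀ m n → ι ℕ.∣ m - n ∣ ≡ ∣ ι m - ι n ∣
  ι-∣-∣ m n with ℕ.≤-total m n
  ... | inj₁ m≤n with k , refl ← ℕ.m≤n⇒∃[o]m+o≡n m≤n = sym (begin
    ∣ ι m - ι (m ℕ.+ k) ∣     ≡⟨ cong (λ x → ∣ ι m - x ∣) (ι-+ m k) ⟩
    ∣ ι m - (ι m + ι k) ∣     ≡⟨ cong ∣_∣ (solve 2 (λ a b → a :- (a :+ b) := :- b) refl (ι m) (ι k)) ⟩
    ∣ - ι k ∣                 ≡⟨ ∣-p∣≡∣p∣ (ι k) ⟩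
    ∣ ι k ∣                   ≡⟨ 0≤p⇒∣p∣≡p (0≤ι k) ⟩
    ι k                       ≡⟨ cong ι (ℕ.∣m-m+n∣≡n m k) ⟨
    ι ℕ.∣ m - m ℕ.+ k ∣       ∎)
    where open ≡-Reasoning
  ι-∣-∣ m n | inj₂ n≤m with k , refl ← ℕ.m≤n⇒∃[o]m+o≡n n≤m = sym (begin
    ∣ ι (n ℕ.+ k) - ι n ∣     ≡⟨ cong (λ x → ∣ x - ι n ∣) (ι-+ n k) ⟩
    ∣ (ι n + ι k) - ι n ∣     ≡⟨ cong ∣_∣ (solve 2 (λ a b → (a :+ b) :- a := b) refl (ι n) (ι k)) ⟩
    ∣ ι k ∣                   ≡⟨ 0≤p⇒∣p∣≡p (0≤ι k) ⟩
    ι k                       ≡⟨ cong ι (trans (ℕ.∣-∣-comm (n ℕ.+ k) n) (ℕ.∣m-m+n∣≡n n k)) ⟨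
    ι ℕ.∣ n ℕ.+ k - n ∣       ∎)
    where open ≡-Reasoning

  half-cancel : ∀ {x y} → ½ * x ≤ ½ * y → x ≤ y
  half-cancel = *-cancelˡ-≤-pos ½

  ½≤p : ∀ p {ε} → ε ≤ ½ → ∣ p - 1ℚ ∣ ≤ ε → ½ ≤ p
  ½≤p p ε≤½ h = begin
    ½                       ≡⟨ solve 1 (λ p → con ½ := (p :+ (con 1ℚ :- p)) :- con ½) refl p ⟩
    p + (1ℚ - p) - ½        ≤⟨ +-monoˡ-≤ (- ½) (+-monoʳ-≤ p (≤-trans (p≤∣p∣ (1ℚ - p))
                                 (≤-trans (≤-reflexive (∣-∣-comm 1ℚ p)) (≤-trans h ε≤½)))) ⟩
    p + ½ - ½               ≡⟨ solve 1 (λ p → p :+ con ½ :- con ½ := p) refl p ⟩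
    p                       ∎
    where open ≤-Reasoning

  -- A factor within `½` of 1 is at least `½`, so dividing by it at most doubles a bound.
  cancel-near-1 : ∀ p x {y ε} → ε ≤ ½ → ∣ p - 1ℚ ∣ ≤ ε → ∣ p * x ∣ ≤ ½ * y → ∣ x ∣ ≤ y
  cancel-near-1 p x {y} ε≤½ h bound = half-cancel (begin
    ½ * ∣ x ∣    ≤⟨ *-monoʳ-≤-nonNeg ∣ x ∣ {{∣-∣-nonNeg x}} ½≤p′ ⟩
    p * ∣ x ∣    ≡⟨ ∣cp∣≡c∣p∣ (≤-trans (nonNegative⁻¹ ½) ½≤p′) x ⟨
    ∣ p * x ∣    ≤⟨ bound ⟩
    ½ * y        ∎)
    where
    open ≤-Reasoning
    ½≤p′ : ½ ≤ p
    ½≤p′ = ½≤p p ε≤½ h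

  -- Meant for `p = ρ / G`, `q = ρ′ / G′` and `s = G′ / G`, where `G` and `G′` approximate
  -- consecutive values of `g`. Then `p * (ρ′ - ρ) = ρ * (q * s - p)`, the last factor is at most
  -- `4 ε`, and cancelling `p` doubles this.
  ratio-closeness : ∀ {p q s ρ ρ′ ε} → 0ℚ ≤ ρ → 0ℚ ≤ ε → ε ≤ ½ →
                    ∣ p - 1ℚ ∣ ≤ ε → ∣ q - 1ℚ ∣ ≤ ε → ∣ s - 1ℚ ∣ ≤ ε →
                    ρ′ * p ≡ q * s * ρ → ∣ ρ′ - ρ ∣ ≤ ι 8 * ε * ρ
  ratio-closeness {p} {q} {s} {ρ} {ρ′} {ε} 0≤ρ 0≤ε ε≤½ hp hq hs eq = cancel-near-1 p (ρ′ - ρ) ε≤½ hp (begin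
    ∣ p * (ρ′ - ρ) ∣
      ≡⟨ cong ∣_∣ (trans (solve 3 (λ p x y → p :* (x :- y) := x :* p :- p :* y) refl p ρ′ ρ)
           (trans (cong (_- p * ρ) eq)
             (solve 4 (λ p q s y → q :* s :* y :- p :* y
               := y :* (((q :- con 1ℚ) :* (s :- con 1ℚ) :+ (q :- con 1ℚ)) :+ ((s :- con 1ℚ) :- (p :- con 1ℚ)))) refl p q s ρ))) ⟩
    ∣ ρ * ((q′ * s′ + q′) + (s′ - p′)) ∣
      ≡⟨ ∣cp∣≡c∣p∣ 0≤ρ ((q′ * s′ + q′) + (s′ - p′)) ⟩
    ρ * ∣ (q′ * s′ + q′) + (s′ - p′) ∣
      ≤⟨ *-monoˡ-≤-nonNeg ρ {{nonNegative 0≤ρ}} (begin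
           ∣ (q′ * s′ + q′) + (s′ - p′) ∣
             ≤⟨ ∣p+q∣≤∣p∣+∣q∣ (q′ * s′ + q′) (s′ - p′) ⟩
           ∣ q′ * s′ + q′ ∣ + ∣ s′ - p′ ∣
             ≤⟨ +-mono-≤ (∣p+q∣≤∣p∣+∣q∣ (q′ * s′) q′) (∣p-q∣≤∣p∣+∣q∣ s′ p′) ⟩
           (∣ q′ * s′ ∣ + ∣ q′ ∣) + (∣ s′ ∣ + ∣ p′ ∣)
             ≤⟨ +-mono-≤ (+-mono-≤ q′s′≤ε hq) (+-mono-≤ hs hp) ⟩
           (ε + ε) + (ε + ε) ∎) ⟩
    ρ * ((ε + ε) + (ε + ε))
      ≡⟨ solve 2 (λ y e → y :* ((e :+ e) :+ (e :+ e)) := con ½ :* (con (ι 8) :* e :* y)) refl ρ ε ⟩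
    ½ * (ι 8 * ε * ρ) ∎)
    where
    open ≤-Reasoning
    p′ = p - 1ℚ
    q′ = q - 1ℚ
    s′ = s - 1ℚ
    q′s′≤ε : ∣ q′ * s′ ∣ ≤ ε
    q′s′≤ε = begin
      ∣ q′ * s′ ∣        ≡⟨ ∣p*q∣≡∣p∣*∣q∣ q′ s′ ⟩
      ∣ q′ ∣ * ∣ s′ ∣    ≤⟨ *-monoˡ-≤-nonNeg ∣ q′ ∣ {{∣-∣-nonNeg q′}} (≤-trans hs (≤-trans ε≤½ (toℚᵘ-cancel-≤ (ℚᵘ.*≤* (ℤ.+≤+ (ℕ.s≤s ℕ.z≤n)))))) ⟩
      ∣ q′ ∣ * 1ℚ        ≡⟨ *-identityʳ ∣ q′ ∣ ⟩
      ∣ q′ ∣             ≤⟨ hq ⟩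
      ε                  ∎

  -- With `p = ρ / G`, the product `p * (G - a)` equals `(ρ - a) - a * (p - 1)`.
  quotient-closeness : ∀ {p ρ a G ε} → 0ℚ ≤ a → ε ≤ ½ → ∣ p - 1ℚ ∣ ≤ ε → ∣ ρ - a ∣ ≤ ε →
                       p * G ≡ ρ → ∣ G - a ∣ ≤ ι 2 * (ε * (1ℚ + a))
  quotient-closeness {p} {ρ} {a} {G} {ε} 0≤a ε≤½ hp hρ pG≡ρ = cancel-near-1 p (G - a) ε≤½ hp (begin
    ∣ p * (G - a) ∣
      ≡⟨ cong ∣_∣ (trans (solve 3 (λ p G a → p :* (G :- a) := p :* G :- a :- a :* (p :- con 1ℚ)) refl p G a)
                         (cong (λ x → x - a - a * (p - 1ℚ)) pG≡ρ)) ⟩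
    ∣ (ρ - a) - a * (p - 1ℚ) ∣
      ≤⟨ ∣p-q∣≤∣p∣+∣q∣ (ρ - a) (a * (p - 1ℚ)) ⟩
    ∣ ρ - a ∣ + ∣ a * (p - 1ℚ) ∣
      ≤⟨ +-mono-≤ hρ (≤-trans (≤-reflexive (∣cp∣≡c∣p∣ 0≤a (p - 1ℚ))) (*-monoˡ-≤-nonNeg a {{nonNegative 0≤a}} hp)) ⟩
    ε + a * ε
      ≡⟨ solve 2 (λ e a → e :+ a :* e := con ½ :* (con (ι 2) :* (e :* (con 1ℚ :+ a)))) refl ε a ⟩
    ½ * (ι 2 * (ε * (1ℚ + a))) ∎)
    where open ≤-Reasoning

-- Translation between limits of reals and inequalities of natural numbers.

module Limits where

  open import Data.Integer.Base using (+_; +[1+_])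
  import Data.Nat.Properties as ℕ
  open import Data.Rational.Base hiding (pos)
  open import Data.Rational.Properties
  open import Data.Rational.Solver using (module +-*-Solver)
  open import Defs as ℝ
    using (seq; fromℚ; fromℕ; inv; inv-inverse; ℕ⁺; pos; value; value-nonZero; suc⁺; _/⁺_; _∼_; _⟶_; Bounded)
  open Recurrence using (NearlyGeometric; RatiosConverge)
  open Rationals
  open +-*-Solver

  -- The numerator of a positive rational is at least 1.
  archimedean : ∀ δ .{{_ : Positive δ}} → 1ℚ ≤ δ * ι (↧ₙ δ)
  archimedean δ@(mkℚ +[1+ n ] d _) = subst (1ℚ ≤_)
    (trans (sym (ι-/ (suc n) (suc d))) (cong (_* ι (suc d)) (↥p/↧p≡p δ)))
    (ι-mono-≤ {1} {suc n} (ℕ.s≤s ℕ.z≤n))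

  1/suc : ℕ → ℚ
  1/suc k = + 1 / suc k

  1/suc-inverse : ∀ k → 1/suc k * ι (suc k) ≡ 1ℚ
  1/suc-inverse k = ι-/ 1 (suc k)

  0<1/suc : ∀ k → 0ℚ < 1/suc k
  0<1/suc k = positive⁻¹ (1/suc k) {{normalize-pos 1 (suc k)}}

  1/suc≤½ : ∀ k .{{_ : ℕ.NonZero k}} → 1/suc k ≤ ½
  1/suc≤½ k = *-cancelʳ-≤-pos (ι 2) (begin
    1/suc k * ι 2        ≤⟨ *-monoˡ-≤-nonNeg (1/suc k) {{nonNegative (<⇒≤ (0<1/suc k))}} (ι-mono-≤ (ℕ.s≤s (ℕ.>-nonZero⁻¹ k))) ⟩
    1/suc k * ι (suc k)  ≡⟨ 1/suc-inverse k ⟩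
    1ℚ                   ∎)
    where open ≤-Reasoning

  eventually-≤ : ∀ {x ε} → x ℝ.< fromℚ ε → ∃[ M ] ∀ m → M ℕ.≤ m → seq x m ≤ ε
  eventually-≤ {x} (δ , 0<δ , M , h) = M , λ m M≤m → ≤-trans
    (≤-trans (≤-reflexive (sym (+-identityʳ (seq x m)))) (+-monoʳ-≤ (seq x m) (<⇒≤ 0<δ))) (h m M≤m)

  -- Replaces the real limit by bounds on rational approximations. The threshold `M` depends on `n`,
  -- so an approximation index is chosen only after `n`.
  ∼⇒close : ∀ u v → u ∼ v → ∀ k → ∃[ N ] ∀ n → N ℕ.≤ n →
            ∃[ M ] ∀ m → M ℕ.≤ m → ∣ seq (u (pos (suc n))) m * inv (seq (v (pos (suc n))) m) - 1ℚ ∣ ≤ 1/suc k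
  ∼⇒close u v u∼v k =
    let N , h = u∼v (fromℚ (1/suc k)) (1/suc k , 0<1/suc k , 0 , λ _ _ → ≤-reflexive (+-identityˡ (1/suc k)))
    in N , λ n N≤n → let v#0 , lt = h (pos (suc n)) (ℕ.m≤n⇒m≤1+n N≤n)
                     in eventually-≤ {x = ℝ.∣ u (pos (suc n)) ℝ.÷ v (pos (suc n)) [ v#0 ] ℝ.- ℝ.1ℝ ∣} lt

  -- The default value `inv 0 = 0` would put the product at distance 1 from 1, so `G` is nonzero.
  inv-inverse-near-1 : ∀ ρ G {ε} → ε ≤ ½ → ∣ ρ * inv G - 1ℚ ∣ ≤ ε → inv G * G ≡ 1ℚ
  inv-inverse-near-1 ρ G ε≤½ h = inv-inverse {G} λ { refl → <-irrefl refl (<-≤-trans (positive⁻¹ ½)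
    (subst (½ ≤_) (*-zeroʳ ρ) (½≤p (ρ * inv 0ℚ) ε≤½ h))) }

  /⁺-* : ∀ m n → (+ value m / value n) {{value-nonZero n}} * ι (value n) ≡ ι (value m)
  /⁺-* m n = ι-/ (value m) (value n) {{value-nonZero n}}

  -- For `ρ = y / x` and `ρ′ = z / y`, multiplying by `x * y` turns `ρ′ - ρ` into `z * x - y * y`
  -- and `ρ` into `y * y`.
  ratio-closeness-ℕ : ∀ K {x y z ρ ρ′} → ρ * ι x ≡ ι y → ρ′ * ι y ≡ ι z → ι K * ∣ ρ′ - ρ ∣ ≤ ρ →
                      K ℕ.* ℕ.∣ z ℕ.* x - y ℕ.* y ∣ ℕ.≤ y ℕ.* y
  ratio-closeness-ℕ K {x} {y} {z} {ρ} {ρ′} ρx≡y ρ′y≡z h = ι-cancel-≤ (begin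
    ι (K ℕ.* ℕ.∣ z ℕ.* x - y ℕ.* y ∣)         ≡⟨ ι-* K _ ⟩
    ι K * ι ℕ.∣ z ℕ.* x - y ℕ.* y ∣           ≡⟨ cong (ι K *_) (ι-∣-∣ (z ℕ.* x) (y ℕ.* y)) ⟩
    ι K * ∣ ι (z ℕ.* x) - ι (y ℕ.* y) ∣       ≡⟨ cong (λ t → ι K * ∣ t ∣) factor ⟩
    ι K * ∣ ι (x ℕ.* y) * (ρ′ - ρ) ∣          ≡⟨ cong (ι K *_) (∣cp∣≡c∣p∣ (0≤ι (x ℕ.* y)) (ρ′ - ρ)) ⟩
    ι K * (ι (x ℕ.* y) * ∣ ρ′ - ρ ∣)          ≡⟨ solve 3 (λ a b c → a :* (b :* c) := b :* (a :* c)) refl (ι K) (ι (x ℕ.* y)) ∣ ρ′ - ρ ∣ ⟩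
    ι (x ℕ.* y) * (ι K * ∣ ρ′ - ρ ∣)          ≤⟨ *-monoˡ-≤-nonNeg (ι (x ℕ.* y)) {{nonNegative (0≤ι (x ℕ.* y))}} h ⟩
    ι (x ℕ.* y) * ρ                           ≡⟨ cong (_* ρ) (ι-* x y) ⟩
    ι x * ι y * ρ                             ≡⟨ solve 3 (λ a b c → a :* b :* c := (c :* a) :* b) refl (ι x) (ι y) ρ ⟩
    ρ * ι x * ι y                             ≡⟨ cong (_* ι y) ρx≡y ⟩
    ι y * ι y                                 ≡⟨ ι-* y y ⟨
    ι (y ℕ.* y)                               ∎)
    where
    open ≤-Reasoning
    factor : ι (z ℕ.* x) - ι (y ℕ.* y) ≡ ι (x ℕ.* y) * (ρ′ - ρ)
    factor = begin-equality
      ι (z ℕ.* x) - ι (y ℕ.* y)               ≡⟨ cong₂ _-_ (ι-* z x) (ι-* y y) ⟩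
      ι z * ι x - ι y * ι y                   ≡⟨ cong₂ (λ s t → s * ι x - t * ι y) (sym ρ′y≡z) (sym ρx≡y) ⟩
      ρ′ * ι y * ι x - ρ * ι x * ι y          ≡⟨ solve 4 (λ r s a b → s :* b :* a :- r :* a :* b := a :* b :* (s :- r)) refl ρ ρ′ (ι x) (ι y) ⟩
      ι x * ι y * (ρ′ - ρ)                    ≡⟨ cong (_* (ρ′ - ρ)) (ι-* x y) ⟨
      ι (x ℕ.* y) * (ρ′ - ρ)                  ∎

  values : (ℕ⁺ → ℕ⁺) → ℕ → ℕ
  values f n = value (f (pos (suc n)))

  ratiosConverge : ∀ {f g} → (λ n → g (suc⁺ n)) ∼ g → (λ n → f (suc⁺ n) /⁺ f n) ∼ g →
                   RatiosConverge (values f)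
  ratiosConverge {f} {g} g′∼g f′/f∼g K =
    -- Chosen with `suc k = 8 * suc K`, to cancel the factor 8 of `ratio-closeness`. Using `suc K`
    -- covers `K = 0`.
    let k = K ℕ.+ 7 ℕ.* suc K
        ε = 1/suc k
        ε≤½ = 1/suc≤½ k {{ℕ.≢-nonZero λ k≡0 → ℕ.m+1+n≢0 K k≡0}}
        N₁ , close₁ = ∼⇒close (λ n → f (suc⁺ n) /⁺ f n) g f′/f∼g k
        N₂ , close₂ = ∼⇒close (λ n → g (suc⁺ n)) g g′∼g k
    in N₁ ℕ.⊔ N₂ , λ n N≤n →
      let N₁≤n = ℕ.m⊔n≤o⇒m≤o N₁ N₂ N≤n
          M₁ , p≈1 = close₁ n N₁≤n
          M₂ , q≈1 = close₁ (suc n) (ℕ.m≤n⇒m≤1+n N₁≤n)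
          M₃ , s≈1 = close₂ n (ℕ.m⊔n≤o⇒n≤o N₁ N₂ N≤n)
          -- One approximation index beyond all three thresholds is enough, because `ρ` and `ρ′` do
          -- not depend on it.
          m = M₁ ℕ.+ (M₂ ℕ.+ M₃)
          fₙ = f (pos (suc n))
          fₙ₊₁ = f (pos (suc (suc n)))
          fₙ₊₂ = f (pos (suc (suc (suc n))))
          ρ  = (+ value fₙ₊₁ / value fₙ) {{value-nonZero fₙ}}
          ρ′ = (+ value fₙ₊₂ / value fₙ₊₁) {{value-nonZero fₙ₊₁}}
          G  = seq (g (pos (suc n))) m
          G′ = seq (g (pos (suc (suc n)))) m
          hp = p≈1 m (ℕ.m≤m+n M₁ (M₂ ℕ.+ M₃))
          hq = q≈1 m (ℕ.≤-trans (ℕ.m≤m+n M₂ M₃) (ℕ.m≤n+m (M₂ ℕ.+ M₃) M₁))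
          hs = s≈1 m (ℕ.≤-trans (ℕ.m≤n+m M₃ M₂) (ℕ.m≤n+m (M₂ ℕ.+ M₃) M₁))
          0≤ρ : 0ℚ ≤ ρ
          0≤ρ = *-cancelʳ-≤-pos (ι (value fₙ)) {{ι-pos (value fₙ) {{value-nonZero fₙ}}}}
                  (subst₂ _≤_ (sym (*-zeroˡ (ι (value fₙ)))) (sym (/⁺-* fₙ₊₁ fₙ)) (0≤ι (value fₙ₊₁)))
          open ≤-Reasoning
      in ratio-closeness-ℕ K {value fₙ} {value fₙ₊₁} {value fₙ₊₂} {ρ} {ρ′} (/⁺-* fₙ₊₁ fₙ) (/⁺-* fₙ₊₂ fₙ₊₁) (begin
        ι K * ∣ ρ′ - ρ ∣
          ≤⟨ *-monoʳ-≤-nonNeg ∣ ρ′ - ρ ∣ {{∣-∣-nonNeg (ρ′ - ρ)}} (ι-mono-≤ (ℕ.n≤1+n K)) ⟩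
        ι (suc K) * ∣ ρ′ - ρ ∣
          ≤⟨ *-monoˡ-≤-nonNeg (ι (suc K)) {{nonNegative (0≤ι (suc K))}}
               (ratio-closeness {ρ * inv G} {ρ′ * inv G′} {G′ * inv G} {ρ} {ρ′} {ε} 0≤ρ (<⇒≤ (0<1/suc k)) ε≤½ hp hq hs (begin-equality
                 ρ′ * (ρ * inv G)
                   ≡⟨ solve 3 (λ a b c → a :* (b :* c) := a :* con 1ℚ :* (c :* b)) refl ρ′ ρ (inv G) ⟩
                 ρ′ * 1ℚ * (inv G * ρ)
                   ≡⟨ cong (λ t → ρ′ * t * (inv G * ρ)) (inv-inverse-near-1 ρ′ G′ ε≤½ hq) ⟨
                 ρ′ * (inv G′ * G′) * (inv G * ρ)
                   ≡⟨ solve 5 (λ a b c d e → a :* (b :* c) :* (d :* e) := a :* b :* (c :* d) :* e) refl ρ′ (inv G′) G′ (inv G) ρ ⟩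
                 ρ′ * inv G′ * (G′ * inv G) * ρ ∎)) ⟩
        ι (suc K) * (ι 8 * ε * ρ)
          ≡⟨ solve 4 (λ a b c d → a :* (b :* c :* d) := c :* (b :* a) :* d) refl (ι (suc K)) (ι 8) ε ρ ⟩
        ε * (ι 8 * ι (suc K)) * ρ
          ≡⟨ cong (λ t → ε * t * ρ) (ι-* 8 (suc K)) ⟨
        ε * ι (suc k) * ρ
          ≡⟨ cong (_* ρ) (1/suc-inverse k) ⟩
        1ℚ * ρ
          ≡⟨ *-identityˡ ρ ⟩
        ρ ∎)

  ι-difference : ∀ a x y → ∣ ι y - ι a * ι x ∣ ≡ ι ℕ.∣ y - a ℕ.* x ∣
  ι-difference a x y = trans (cong (λ t → ∣ ι y - t ∣) (sym (ι-* a x))) (sym (ι-∣-∣ y (a ℕ.* x)))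

  quotient-near : ∀ k a {x y ρ} .{{_ : ℕ.NonZero x}} → ρ * ι x ≡ ι y →
                  suc k ℕ.* ℕ.∣ y - a ℕ.* x ∣ ℕ.≤ x → ∣ ρ - ι a ∣ ≤ 1/suc k
  quotient-near k a {x} {y} {ρ} ρx≡y h =
    *-cancelˡ-≤-pos (ι x) {{ι-pos x}} (*-cancelˡ-≤-pos (ι (suc k)) {{ι-pos (suc k)}} (begin
      ι (suc k) * (ι x * ∣ ρ - ι a ∣)          ≡⟨ cong (ι (suc k) *_) (∣cp∣≡c∣p∣ (0≤ι x) (ρ - ι a)) ⟨
      ι (suc k) * ∣ ι x * (ρ - ι a) ∣          ≡⟨ cong (λ t → ι (suc k) * ∣ t ∣) (trans
                                                   (solve 3 (λ x r a → x :* (r :- a) := r :* x :- a :* x) refl (ι x) ρ (ι a))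
                                                   (cong (_- ι a * ι x) ρx≡y)) ⟩
      ι (suc k) * ∣ ι y - ι a * ι x ∣          ≡⟨ cong (ι (suc k) *_) (ι-difference a x y) ⟩
      ι (suc k) * ι ℕ.∣ y - a ℕ.* x ∣          ≡⟨ ι-* (suc k) ℕ.∣ y - a ℕ.* x ∣ ⟨
      ι (suc k ℕ.* ℕ.∣ y - a ℕ.* x ∣)          ≤⟨ ι-mono-≤ h ⟩
      ι x                                      ≡⟨ *-identityʳ (ι x) ⟨
      ι x * 1ℚ                                 ≡⟨ cong (ι x *_) (1/suc-inverse k) ⟨
      ι x * (1/suc k * ι (suc k))              ≡⟨ solve 3 (λ x e k → x :* (e :* k) := k :* (x :* e)) refl (ι x) (1/suc k) (ι (suc k)) ⟩
      ι (suc k) * (ι x * 1/suc k)              ∎))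
    where open ≤-Reasoning

  -- The denominator is `4 * (d + 1) * (a + 1)`, so the left side is `1 / (2 * (d + 1))`.
  tolerance : ∀ a d {δ} → 1ℚ ≤ δ * ι (suc d) →
              ι 2 * (1/suc (3 ℕ.+ 4 ℕ.* (a ℕ.+ d ℕ.* suc a)) * (1ℚ + ι a)) ≤ ½ * δ
  tolerance a d {δ} 1≤δd = *-cancelʳ-≤-pos (ι 2 * ι (suc d)) {{pos*pos⇒pos (ι 2) (ι (suc d)) {{ι-pos (suc d)}}}} (begin
    ι 2 * (e * (1ℚ + ι a)) * (ι 2 * ι (suc d))
      ≡⟨ solve 3 (λ e a d → con (ι 2) :* (e :* (con 1ℚ :+ a)) :* (con (ι 2) :* d)
           := e :* (con (ι 4) :* (d :* (con 1ℚ :+ a)))) refl e (ι a) (ι (suc d)) ⟩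
    e * (ι 4 * (ι (suc d) * (1ℚ + ι a)))
      ≡⟨ cong (λ t → e * (ι 4 * (ι (suc d) * t))) (ι-+ 1 a) ⟨
    e * (ι 4 * (ι (suc d) * ι (suc a)))
      ≡⟨ cong (e *_) (trans (cong (ι 4 *_) (sym (ι-* (suc d) (suc a)))) (sym (ι-* 4 (suc d ℕ.* suc a)))) ⟩
    e * ι (4 ℕ.* (suc d ℕ.* suc a))
      ≡⟨ cong (λ t → e * ι t) (ℕ.*-suc 4 (a ℕ.+ d ℕ.* suc a)) ⟩
    e * ι (suc k)
      ≡⟨ 1/suc-inverse k ⟩
    1ℚ
      ≤⟨ 1≤δd ⟩
    δ * ι (suc d)
      ≡⟨ solve 2 (λ δ d → δ :* d := con ½ :* δ :* (con (ι 2) :* d)) refl δ (ι (suc d)) ⟩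
    ½ * δ * (ι 2 * ι (suc d)) ∎)
    where
    open ≤-Reasoning
    k = 3 ℕ.+ 4 ℕ.* (a ℕ.+ d ℕ.* suc a)
    e = 1/suc k

  nearlyGeometric⇒⟶ : ∀ {f g a} → (λ n → f (suc⁺ n) /⁺ f n) ∼ g → NearlyGeometric (values f) a → g ⟶ fromℕ a
  nearlyGeometric⇒⟶ {f} {g} {a} f′/f∼g (_ , near) ε (δ , 0<δ , M₀ , δ≤ε) =
    let instance
          _ = positive 0<δ
        d = ℚ.denominator-1 δ
        k = 3 ℕ.+ 4 ℕ.* (a ℕ.+ d ℕ.* suc a)
        e = 1/suc k
        e≤½ = 1/suc≤½ k
        N₁ , close = ∼⇒close (λ n → f (suc⁺ n) /⁺ f n) g f′/f∼g k
        N₂ , near′ = near (suc k)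
        small = tolerance a d {δ} (archimedean δ)
    in suc (N₁ ℕ.⊔ N₂) , λ { (pos (suc n)) (ℕ.s≤s N≤n) →
      let M₁ , p≈1 = close n (ℕ.m⊔n≤o⇒m≤o N₁ N₂ N≤n)
          fₙ = f (pos (suc n))
          fₙ₊₁ = f (pos (suc (suc n)))
          ρ  = (+ value fₙ₊₁ / value fₙ) {{value-nonZero fₙ}}
      -- One half of `δ` bounds the distance to the limit, the other half is the margin that the
      -- strict inequality of reals demands.
      in ½ * δ , positive⁻¹ (½ * δ) {{pos*pos⇒pos ½ δ}} , M₀ ℕ.⊔ M₁ , λ m M≤m →
        let G = seq (g (pos (suc n))) m
            hp = p≈1 m (ℕ.m⊔n≤o⇒n≤o M₀ M₁ M≤m)
            open ≤-Reasoning
        in begin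
          ∣ G - ι a ∣ + ½ * δ
            ≤⟨ +-monoˡ-≤ (½ * δ) (≤-trans (quotient-closeness {ρ * inv G} {ρ} {ι a} {G} {e} (0≤ι a) e≤½ hp
                 (quotient-near k a {value fₙ} {value fₙ₊₁} {ρ} {{value-nonZero fₙ}} (/⁺-* fₙ₊₁ fₙ) (near′ n (ℕ.m⊔n≤o⇒n≤o N₁ N₂ N≤n)))
                 (trans (*-assoc ρ (inv G) G) (trans (cong (ρ *_) (inv-inverse-near-1 ρ G e≤½ hp)) (*-identityʳ ρ)))) small) ⟩
          ½ * δ + ½ * δ
            ≡⟨ solve 1 (λ d → con ½ :* d :+ con ½ :* d := con 0ℚ :+ d) refl δ ⟩
          0ℚ + δ
            ≤⟨ δ≤ε m (ℕ.m⊔n≤o⇒m≤o M₀ M₁ M≤m) ⟩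
          seq ε m ∎ }

  nearlyGeometric⇒bounded : ∀ {f a} → (∀ m n → value m ℕ.≤ value n → value (f m) ℕ.≤ value (f n)) →
    NearlyGeometric (values f) a →
    Bounded (λ n → fromℕ (value (f (suc⁺ n))) ℝ.- fromℕ a ℝ.* fromℕ (value (f n)))
  nearlyGeometric⇒bounded {f} {a} f-mono ((N , bound) , _) = fromℕ B , λ { (pos (suc n)) ε 0<ε →
    0 , λ m _ → ≤-trans (≤-reflexive (ι-difference a (values f n) (values f (suc n))))
      (≤-trans (ι-mono-≤ (bounded n)) (≤-trans (≤-reflexive (sym (+-identityʳ (ι B)))) (+-monoʳ-≤ (ι B) (<⇒≤ 0<ε)))) }
    where
    F = values f
    -- For the finitely many indices up to `N`, monotonicity bounds both terms of the difference by
    -- their values at `N`.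
    C = F (suc N) ℕ.⊔ a ℕ.* F N
    B = a ℕ.⊔ C
    bounded : ∀ n → ℕ.∣ F (suc n) - a ℕ.* F n ∣ ℕ.≤ B
    bounded n with ℕ.≤-total N n
    ... | inj₁ N≤n = ℕ.≤-trans (bound n N≤n) (ℕ.m≤m⊔n a C)
    ... | inj₂ n≤N = ℕ.≤-trans (ℕ.∣m-n∣≤m⊔n (F (suc n)) (a ℕ.* F n)) (ℕ.≤-trans
      (ℕ.⊔-mono-≤ (f-mono (pos (suc (suc n))) (pos (suc (suc N))) (ℕ.s≤s (ℕ.s≤s n≤N)))
                  (ℕ.*-monoʳ-≤ a (f-mono (pos (suc n)) (pos (suc N)) (ℕ.s≤s n≤N))))
      (ℕ.m≤n⊔m a C))

-- Digit words and the remainders of long division.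

module Expansions where

  open import Algebra.Definitions.RawSemiring using () renaming (_^_ to pow)
  open import Data.Digit using (Digit; fromDigits; toDigits)
  open import Data.Fin.Base using (toℕ)
  open import Data.Fin.Properties using (toℕ<n)
  import Data.Integer.Base as ℤ
  open import Data.List.Base as List using (List; []; _∷_; _∷ʳ_; length)
  import Data.List.Properties as List
  open import Data.List.NonEmpty as List⁺ using (List⁺; _∷_; toList)
  open import Data.Nat.Base
  open import Data.Nat.Properties
  open import Data.Nat.Tactic.RingSolver using (solve-∀)
  open import Data.Rational.Base as ℚ using (ℚ; 0ℚ; 1ℚ; mkℚ)
  import Data.Rational.Properties as ℚ
  import Data.Rational.Solver as ℚ
  open import Data.Vec.Base as Vec using (Vec; _∷_)
  import Data.Vec.Properties as Vec
  open import Defs using (value; value-nonZero; digits; _++concat_; concat∞; partialSum; 1/b; 0∙_; Rational)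
  open Rationals using (ι; 0≤ι; ι-pos; ι-+; ι-*; ι-/; ι-∣-∣; ι-cancel-≤; p≤∣p∣; ∣cp∣≡c∣p∣)
  open Limits using (1/suc; 1/suc-inverse; 0<1/suc)

  module _ {b : ℕ} where

    -- Reads the most significant digit first, the order within a block, whereas `fromDigits` reads
    -- the least significant one first.
    numeral : List (Digit b) → ℕ
    numeral []       = 0
    numeral (d ∷ ds) = toℕ d * b ^ length ds + numeral ds

    numeral-∷ʳ : ∀ ds d → numeral (ds ∷ʳ d) ≡ toℕ d + numeral ds * b
    numeral-∷ʳ []       d = trans (+-identityʳ (toℕ d * 1)) (trans (*-identityʳ (toℕ d)) (sym (+-identityʳ (toℕ d))))
    numeral-∷ʳ (e ∷ ds) d = begin
      toℕ e * b ^ length (ds ∷ʳ d) + numeral (ds ∷ʳ d)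
        ≡⟨ cong₂ (λ l v → toℕ e * b ^ l + v) (trans (List.length-++ ds) (+-comm (length ds) 1)) (numeral-∷ʳ ds d) ⟩
      toℕ e * (b * b ^ length ds) + (toℕ d + numeral ds * b)
        ≡⟨ lemma (toℕ e) b (b ^ length ds) (toℕ d) (numeral ds) ⟩
      toℕ d + (toℕ e * b ^ length ds + numeral ds) * b ∎
      where
      open ≡-Reasoning
      lemma : ∀ e b B d v → e * (b * B) + (d + v * b) ≡ d + (e * B + v) * b
      lemma = solve-∀

    numeral-reverse : ∀ ds → numeral (List.reverse ds) ≡ fromDigits ds
    numeral-reverse []       = refl
    numeral-reverse (d ∷ ds) = begin
      numeral (List.reverse (d ∷ ds))             ≡⟨ cong numeral (List.unfold-reverse d ds) ⟩
      numeral (List.reverse ds ∷ʳ d)              ≡⟨ numeral-∷ʳ (List.reverse ds) d ⟩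
      toℕ d + numeral (List.reverse ds) * b       ≡⟨ cong (λ v → toℕ d + v * b) (numeral-reverse ds) ⟩
      toℕ d + fromDigits ds * b                   ∎
      where open ≡-Reasoning

  toList-reverse : ∀ {A : Set} (xs : List⁺ A) → toList (List⁺.reverse xs) ≡ List.reverse (toList xs)
  toList-reverse (x ∷ xs) = trans (toList-fromVec (Vec.reverse (x ∷ Vec.fromList xs)))
    (trans (Vec.toList-reverse (x ∷ Vec.fromList xs)) (cong (λ ys → List.reverse (x ∷ ys)) (Vec.toList∘fromList xs)))
    where
    toList-fromVec : ∀ {A : Set} {n} (xs : Vec A (suc n)) → toList (List⁺.fromVec xs) ≡ Vec.toList xs
    toList-fromVec (x ∷ xs) = refl

  numeral-digits : ∀ b (2≤b : 2 ≤ b) n → numeral (toList (digits b 2≤b n)) ≡ value n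
  numeral-digits b 2≤b n with toDigits b {fromWitness 2≤b} (value n)
  ... | d ∷ ds , eq = trans (cong numeral (toList-reverse (d ∷ ds))) (trans (numeral-reverse (d ∷ ds)) eq)
  ... | []     , eq = contradiction (sym eq) (≢-nonZero⁻¹ (value n) {{value-nonZero n}})

  -- The remainders of the long division that produces the digits D with divisor r.
  Remainders : ∀ {b} → ℕ → (ℕ → Digit b) → (ℕ → ℕ) → Set
  Remainders {b} r D t = ∀ i → b * t i ≡ r * toℕ (D i) + t (suc i)

  -- This is `t` at the total length of the words before the `n`-th. Dropping the first word and
  -- shifting `t` follows the way `_++concat_` unfolds.
  remainderBefore : ∀ {A : Set} → (ℕ → List⁺ A) → (ℕ → ℕ) → ℕ → ℕ
  remainderBefore w t zero    = t 0
  remainderBefore w t (suc n) = remainderBefore (w ∘ suc) (λ i → t (length (toList (w 0)) + i)) n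

  remainderBefore-≤ : ∀ {A : Set} (w : ℕ → List⁺ A) {t r} → (∀ i → t i ≤ r) → ∀ n → remainderBefore w t n ≤ r
  remainderBefore-≤ w t≤r zero    = t≤r 0
  remainderBefore-≤ w t≤r (suc n) = remainderBefore-≤ (w ∘ suc) (λ i → t≤r (length (toList (w 0)) + i)) n

  module _ {b r : ℕ} where

    -- One division step per digit, each scaled by the power of `b` for the digits still to come.
    -- The second component allows reading to continue with the next word.
    read-prefix : ∀ xs (w : ℕ → List⁺ (Digit b)) {t} → Remainders r (xs ++concat w) t →
                  b ^ length xs * t 0 ≡ r * numeral xs + t (length xs) ×
                  Remainders r (concat∞ w) (λ i → t (length xs + i))
    read-prefix []       w {t} h = trans (*-identityˡ (t 0)) (cong (_+ t 0) (sym (*-zeroʳ r))) , h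
    read-prefix (d ∷ xs) w {t} h =
      let read , rest = read-prefix xs w {t ∘ suc} (h ∘ suc)
          B = b ^ length xs
      in (begin
        b * B * t 0                                                     ≡⟨ lemma₁ b B (t 0) ⟩
        B * (b * t 0)                                                   ≡⟨ cong (B *_) (h 0) ⟩
        B * (r * toℕ d + t 1)                                           ≡⟨ lemma₂ B r (toℕ d) (t 1) ⟩
        r * (toℕ d * B) + B * t 1                                       ≡⟨ cong (r * (toℕ d * B) +_) read ⟩
        r * (toℕ d * B) + (r * numeral xs + t (suc (length xs)))        ≡⟨ lemma₃ r (toℕ d * B) (numeral xs) _ ⟩
        r * (toℕ d * B + numeral xs) + t (suc (length xs))              ∎) , rest
      where
      open ≡-Reasoning
      lemma₁ : ∀ b B x → b * B * x ≡ B * (b * x)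
      lemma₁ = solve-∀
      lemma₂ : ∀ B r d x → B * (r * d + x) ≡ r * (d * B) + B * x
      lemma₂ = solve-∀
      lemma₃ : ∀ r x y z → r * x + (r * y + z) ≡ r * (x + y) + z
      lemma₃ = solve-∀

    read-word : ∀ (w : ℕ → List⁺ (Digit b)) {t} → Remainders r (concat∞ w) t → ∀ n →
                b ^ length (toList (w n)) * remainderBefore w t n ≡
                r * numeral (toList (w n)) + remainderBefore w t (suc n)
    -- `concat∞ w` and the first word prepended to the rest agree by computation only once the index
    -- is known to be zero or a successor.
    read-word w {t} h n with read-prefix (toList (w 0)) (w ∘ suc) {t} (λ { zero → h 0 ; (suc i) → h (suc i) })
    read-word w {t} h zero    | read , _    =
      trans read (cong (λ l → r * numeral (toList (w 0)) + t l) (sym (+-identityʳ (length (toList (w 0))))))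
    read-word w {t} h (suc n) | _    , rest = read-word (w ∘ suc) rest n

  -- Long division recovered from a rational value of the expansion.

  module LongDivision {b : ℕ} (2≤b : 2 ≤ b) (D : ℕ → Digit b) where

    private
      instance
        b≢0 : NonZero b
        b≢0 = >-nonZero (≤-trans (s≤s z≤n) 2≤b)

      S : ℕ → ℚ
      S = partialSum b 2≤b D

    prefix : ℕ → ℕ
    prefix zero    = 0
    prefix (suc n) = b * prefix n + toℕ (D n)

    prefix-lower : ∀ k n → prefix n * b ^ k ≤ prefix (k + n)
    prefix-lower zero    n = ≤-reflexive (*-identityʳ (prefix n))
    prefix-lower (suc k) n = begin
      prefix n * (b * b ^ k)                  ≡⟨ lemma (prefix n) b (b ^ k) ⟩
      b * (prefix n * b ^ k)                  ≤⟨ *-monoʳ-≤ b (prefix-lower k n) ⟩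
      b * prefix (k + n)                      ≤⟨ m≤m+n (b * prefix (k + n)) (toℕ (D (k + n))) ⟩
      b * prefix (k + n) + toℕ (D (k + n))    ∎
      where
      open ≤-Reasoning
      lemma : ∀ x y z → x * (y * z) ≡ y * (x * z)
      lemma = solve-∀

    prefix-upper : ∀ k n → suc (prefix (k + n)) ≤ suc (prefix n) * b ^ k
    prefix-upper zero    n = ≤-reflexive (sym (*-identityʳ (suc (prefix n))))
    prefix-upper (suc k) n = begin
      suc (b * prefix (k + n) + toℕ (D (k + n)))   ≡⟨ +-suc (b * prefix (k + n)) _ ⟨
      b * prefix (k + n) + suc (toℕ (D (k + n)))   ≤⟨ +-monoʳ-≤ (b * prefix (k + n)) (toℕ<n (D (k + n))) ⟩
      b * prefix (k + n) + b                       ≡⟨ trans (+-comm _ b) (sym (*-suc b _)) ⟩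
      b * suc (prefix (k + n))                     ≤⟨ *-monoʳ-≤ b (prefix-upper k n) ⟩
      b * (suc (prefix n) * b ^ k)                 ≡⟨ lemma b (suc (prefix n)) (b ^ k) ⟩
      suc (prefix n) * (b * b ^ k)                 ∎
      where
      open ≤-Reasoning
      lemma : ∀ x y z → x * (y * z) ≡ y * (x * z)
      lemma = solve-∀

    private
      w : ℕ → ℚ
      w n = pow ℚ.+-*-rawSemiring (1/b b 2≤b) n

      open ℚ.+-*-Solver

      w-inverse : ∀ n → w n ℚ.* ι (b ^ n) ≡ 1ℚ
      w-inverse zero    = refl
      w-inverse (suc n) = begin
        1/b b 2≤b ℚ.* w n ℚ.* ι (b * b ^ n)               ≡⟨ cong (w (suc n) ℚ.*_) (ι-* b (b ^ n)) ⟩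
        1/b b 2≤b ℚ.* w n ℚ.* (ι b ℚ.* ι (b ^ n))         ≡⟨ solve 4 (λ a b c d → a :* b :* (c :* d) := a :* c :* (b :* d)) refl (1/b b 2≤b) (w n) (ι b) (ι (b ^ n)) ⟩
        1/b b 2≤b ℚ.* ι b ℚ.* (w n ℚ.* ι (b ^ n))         ≡⟨ cong₂ ℚ._*_ (ι-/ 1 b) (w-inverse n) ⟩
        1ℚ                                                ∎
        where open ≡-Reasoning

    partialSum-prefix : ∀ n → S n ℚ.* ι (b ^ n) ≡ ι (prefix n)
    partialSum-prefix zero    = refl
    partialSum-prefix (suc n) = begin
      (S n ℚ.+ ι d ℚ.* w (suc n)) ℚ.* ι (b ^ suc n)
        ≡⟨ solve 4 (λ s d w B → (s :+ d :* w) :* B := s :* B :+ d :* (w :* B)) refl (S n) (ι d) (w (suc n)) (ι (b ^ suc n)) ⟩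
      S n ℚ.* ι (b ^ suc n) ℚ.+ ι d ℚ.* (w (suc n) ℚ.* ι (b ^ suc n))
        ≡⟨ cong₂ ℚ._+_ (cong (S n ℚ.*_) (ι-* b (b ^ n))) (trans (cong (ι d ℚ.*_) (w-inverse (suc n))) (ℚ.*-identityʳ (ι d))) ⟩
      S n ℚ.* (ι b ℚ.* ι (b ^ n)) ℚ.+ ι d
        ≡⟨ cong (ℚ._+ ι d) (trans (solve 3 (λ s b B → s :* (b :* B) := b :* (s :* B)) refl (S n) (ι b) (ι (b ^ n)))
             (trans (cong (ι b ℚ.*_) (partialSum-prefix n)) (sym (ι-* b (prefix n))))) ⟩
      ι (b * prefix n) ℚ.+ ι d
        ≡⟨ ι-+ (b * prefix n) d ⟨
      ι (b * prefix n + d) ∎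
      where
      open ≡-Reasoning
      d = toℕ (D n)

    0≤partialSum : ∀ n → 0ℚ ℚ.≤ S n
    0≤partialSum n = ℚ.*-cancelʳ-≤-pos (ι (b ^ n)) {{ι-pos (b ^ n) {{m^n≢0 b n}}}}
      (subst₂ ℚ._≤_ (sym (ℚ.*-zeroˡ (ι (b ^ n)))) (sym (partialSum-prefix n)) (0≤ι (prefix n)))

    -- The hypothesis `approx` says that the partial sums tend to `p / r`, with denominators
    -- cleared.
    module _ (p r : ℕ) .{{_ : NonZero r}}
             (approx : ∀ k → ∃[ N ] ∀ m → N ≤ m → suc k * ∣ r * prefix m - p * b ^ m ∣ ≤ r * b ^ m) where

      -- An integer gap at position n is magnified by b ^ (m - n) at position m.
      no-persistent-gap : ∀ n → ¬ (∀ k → b ^ k ≤ ∣ r * prefix (k + n) - p * b ^ (k + n) ∣)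
      no-persistent-gap n gap =
        -- Compared with `r * b ^ (N + n)` the gap has size at least `1 / (r * b ^ n)`, just above
        -- the precision requested here.
        let N , h = approx (r * b ^ n)
        in <-irrefl refl (*-cancelʳ-≤ (suc (r * b ^ n)) (r * b ^ n) (b ^ N) {{m^n≢0 b N}} (begin
          suc (r * b ^ n) * b ^ N                   ≤⟨ *-monoʳ-≤ (suc (r * b ^ n)) (gap N) ⟩
          suc (r * b ^ n) * ∣ r * prefix (N + n) - p * b ^ (N + n) ∣ ≤⟨ h (N + n) (m≤m+n N n) ⟩
          r * b ^ (N + n)                           ≡⟨ cong (r *_) (^-distribˡ-+-* b N n) ⟩
          r * (b ^ N * b ^ n)                       ≡⟨ lemma r (b ^ N) (b ^ n) ⟩
          r * b ^ n * b ^ N                         ∎))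
        where
        open ≤-Reasoning
        lemma : ∀ x y z → x * (y * z) ≡ x * z * y
        lemma = solve-∀

      prefix-≤ : ∀ n → r * prefix n ≤ p * b ^ n
      prefix-≤ n with r * prefix n ≤? p * b ^ n
      ... | yes h = h
      ... | no ¬h = contradiction gap (no-persistent-gap n)
        where
        open ≤-Reasoning
        lemma : ∀ p x y → x + p * (x * y) ≡ suc (p * y) * x
        lemma = solve-∀
        gap : ∀ k → b ^ k ≤ ∣ r * prefix (k + n) - p * b ^ (k + n) ∣
        gap k = ≤-trans (m+n≤o⇒m≤o∸n (b ^ k) (begin
          b ^ k + p * b ^ (k + n)          ≡⟨ cong (λ x → b ^ k + p * x) (^-distribˡ-+-* b k n) ⟩
          b ^ k + p * (b ^ k * b ^ n)      ≡⟨ lemma p (b ^ k) (b ^ n) ⟩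
          suc (p * b ^ n) * b ^ k          ≤⟨ *-monoˡ-≤ (b ^ k) (≰⇒> ¬h) ⟩
          r * prefix n * b ^ k             ≡⟨ *-assoc r (prefix n) (b ^ k) ⟩
          r * (prefix n * b ^ k)           ≤⟨ *-monoʳ-≤ r (prefix-lower k n) ⟩
          r * prefix (k + n)               ∎)) (m∸n≤∣m-n∣ (r * prefix (k + n)) (p * b ^ (k + n)))

      -- Equality occurs when all later digits are `b - 1`, which is why remainders may equal `r`.
      ≤-prefix : ∀ n → p * b ^ n ≤ r * suc (prefix n)
      ≤-prefix n with p * b ^ n ≤? r * suc (prefix n)
      ... | yes h = h
      ... | no ¬h = contradiction gap (no-persistent-gap n)
        where
        open ≤-Reasoning
        lemma : ∀ r x y → x + r * (y * x) ≡ suc (r * y) * x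
        lemma = solve-∀
        lemma′ : ∀ p x y → p * x * y ≡ p * (y * x)
        lemma′ = solve-∀
        gap : ∀ k → b ^ k ≤ ∣ r * prefix (k + n) - p * b ^ (k + n) ∣
        gap k = subst (b ^ k ≤_) (∣-∣-comm (p * b ^ (k + n)) (r * prefix (k + n)))
          (≤-trans (m+n≤o⇒m≤o∸n (b ^ k) (begin
          b ^ k + r * prefix (k + n)               ≤⟨ +-monoʳ-≤ (b ^ k) (*-monoʳ-≤ r (≤-trans (n≤1+n _) (prefix-upper k n))) ⟩
          b ^ k + r * (suc (prefix n) * b ^ k)     ≡⟨ lemma r (b ^ k) (suc (prefix n)) ⟩
          suc (r * suc (prefix n)) * b ^ k         ≤⟨ *-monoˡ-≤ (b ^ k) (≰⇒> ¬h) ⟩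
          p * b ^ n * b ^ k                        ≡⟨ lemma′ p (b ^ n) (b ^ k) ⟩
          p * (b ^ k * b ^ n)                      ≡⟨ cong (p *_) (^-distribˡ-+-* b k n) ⟨
          p * b ^ (k + n)                          ∎)) (m∸n≤∣m-n∣ (p * b ^ (k + n)) (r * prefix (k + n))))

      remainder : ℕ → ℕ
      remainder n = p * b ^ n ∸ r * prefix n

      prefix+remainder : ∀ n → r * prefix n + remainder n ≡ p * b ^ n
      prefix+remainder n = m+[n∸m]≡n (prefix-≤ n)

      remainder-≤ : ∀ n → remainder n ≤ r
      remainder-≤ n = m≤n+o⇒m∸n≤o (p * b ^ n) (r * prefix n)
        (≤-trans (≤-prefix n) (≤-reflexive (trans (*-suc r (prefix n)) (+-comm r (r * prefix n)))))

      remainders : Remainders r D remainder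
      remainders n = +-cancelˡ-≡ (r * (b * prefix n)) _ _ (begin
        r * (b * prefix n) + b * remainder n            ≡⟨ lemma₁ r b (prefix n) (remainder n) ⟩
        b * (r * prefix n + remainder n)                ≡⟨ cong (b *_) (prefix+remainder n) ⟩
        b * (p * b ^ n)                                 ≡⟨ lemma₂ b p (b ^ n) ⟩
        p * (b * b ^ n)                                 ≡⟨ prefix+remainder (suc n) ⟨
        r * (b * prefix n + d) + remainder (suc n)      ≡⟨ lemma₃ r (b * prefix n) d (remainder (suc n)) ⟩
        r * (b * prefix n) + (r * d + remainder (suc n)) ∎)
        where
        open ≡-Reasoning
        d = toℕ (D n)
        lemma₁ : ∀ r b x t → r * (b * x) + b * t ≡ b * (r * x + t)
        lemma₁ = solve-∀
        lemma₂ : ∀ x y z → x * (y * z) ≡ y * (x * z)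
        lemma₂ = solve-∀
        lemma₃ : ∀ r x d t → r * (x + d) + t ≡ r * x + (r * d + t)
        lemma₃ = solve-∀

    rational⇒remainders : Rational (0∙_ b 2≤b D) →
      ∃[ r ] NonZero r × ∃[ t ] (∀ n → t n ≤ r) × Remainders r D t
    rational⇒remainders (q@(mkℚ ℤ.-[1+ _ ] _ _) , S≃q) =
      -- Partial sums are nonnegative and keep a distance of at least `- q` from a negative `q`.
      let N , h = S≃q (ℚ.- q) (ℚ.positive⁻¹ (ℚ.- q))
          open ℚ.≤-Reasoning
      in contradiction (begin-strict
        ℚ.- q              ≡⟨ ℚ.+-identityˡ (ℚ.- q) ⟨
        0ℚ ℚ.- q           ≤⟨ ℚ.+-monoˡ-≤ (ℚ.- q) (0≤partialSum N) ⟩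
        S N ℚ.- q          ≤⟨ p≤∣p∣ (S N ℚ.- q) ⟩
        ℚ.∣ S N ℚ.- q ∣    <⟨ h N ≤-refl ⟩
        ℚ.- q              ∎) (ℚ.<-irrefl refl)
    rational⇒remainders (q@(mkℚ (ℤ.+ p) d _) , S≃q) =
      suc d , _ , remainder p r approx , remainder-≤ p r approx , remainders p r approx
      where
      r = suc d
      q*r≡p : q ℚ.* ι r ≡ ι p
      q*r≡p = trans (cong (ℚ._* ι r) (sym (ℚ.↥p/↧p≡p q))) (ι-/ p r)
      approx : ∀ k → ∃[ N ] ∀ m → N ≤ m → suc k * ∣ r * prefix m - p * b ^ m ∣ ≤ r * b ^ m
      approx k =
        let N , h = S≃q (1/suc k) (0<1/suc k)
            open ℚ.≤-Reasoning
        in N , λ m N≤m → ι-cancel-≤ (begin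
          ι (suc k * ∣ r * prefix m - p * b ^ m ∣)
            ≡⟨ trans (ι-* (suc k) ∣ r * prefix m - p * b ^ m ∣) (cong (ι (suc k) ℚ.*_) (ι-∣-∣ (r * prefix m) (p * b ^ m))) ⟩
          ι (suc k) ℚ.* ℚ.∣ ι (r * prefix m) ℚ.- ι (p * b ^ m) ∣
            ≡⟨ cong (λ x → ι (suc k) ℚ.* ℚ.∣ x ∣) (scale m) ⟩
          ι (suc k) ℚ.* ℚ.∣ ι (r * b ^ m) ℚ.* (S m ℚ.- q) ∣
            ≡⟨ cong (ι (suc k) ℚ.*_) (∣cp∣≡c∣p∣ (0≤ι (r * b ^ m)) (S m ℚ.- q)) ⟩
          ι (suc k) ℚ.* (ι (r * b ^ m) ℚ.* ℚ.∣ S m ℚ.- q ∣)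
            ≤⟨ ℚ.*-monoˡ-≤-nonNeg (ι (suc k)) {{ℚ.nonNegative (0≤ι (suc k))}}
                 (ℚ.*-monoˡ-≤-nonNeg (ι (r * b ^ m)) {{ℚ.nonNegative (0≤ι (r * b ^ m))}} (ℚ.<⇒≤ (h m N≤m))) ⟩
          ι (suc k) ℚ.* (ι (r * b ^ m) ℚ.* 1/suc k)
            ≡⟨ solve 3 (λ a b c → a :* (b :* c) := b :* (c :* a)) refl (ι (suc k)) (ι (r * b ^ m)) (1/suc k) ⟩
          ι (r * b ^ m) ℚ.* (1/suc k ℚ.* ι (suc k))
            ≡⟨ trans (cong (ι (r * b ^ m) ℚ.*_) (1/suc-inverse k)) (ℚ.*-identityʳ (ι (r * b ^ m))) ⟩
          ι (r * b ^ m) ∎)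
        where
        scale : ∀ m → ι (r * prefix m) ℚ.- ι (p * b ^ m) ≡ ι (r * b ^ m) ℚ.* (S m ℚ.- q)
        scale m = begin
          ι (r * prefix m) ℚ.- ι (p * b ^ m)
            ≡⟨ cong₂ ℚ._-_ (ι-* r (prefix m)) (ι-* p (b ^ m)) ⟩
          ι r ℚ.* ι (prefix m) ℚ.- ι p ℚ.* ι (b ^ m)
            ≡⟨ cong₂ (λ x y → ι r ℚ.* x ℚ.- y ℚ.* ι (b ^ m)) (sym (partialSum-prefix m)) (sym q*r≡p) ⟩
          ι r ℚ.* (S m ℚ.* ι (b ^ m)) ℚ.- q ℚ.* ι r ℚ.* ι (b ^ m)
            ≡⟨ solve 4 (λ r s B q → r :* (s :* B) :- q :* r :* B := r :* B :* (s :- q)) refl (ι r) (S m) (ι (b ^ m)) q ⟩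
          ι r ℚ.* ι (b ^ m) ℚ.* (S m ℚ.- q)
            ≡⟨ cong (ℚ._* (S m ℚ.- q)) (ι-* r (b ^ m)) ⟨
          ι (r * b ^ m) ℚ.* (S m ℚ.- q) ∎
          where open ≡-Reasoning

-- Long division applied to the blocks `f(1), f(2), …`, with the limit `c = b ^ j`.

open import Defs
open import Data.Integer.Base using (+_)
open import Data.List.Base using (length)
open import Data.List.NonEmpty using (toList)
import Data.Nat.Properties as ℕ
open Recurrence using (NearlyGeometric; module Growth)
open Limits
open Expansions

≃-refl : ∀ x → x ≃ x
≃-refl x ε 0<ε = let N , h = cauchy x ε 0<ε in N , λ n N≤n → h n n N≤n N≤n

theorem2 :
  (b : ℕ) (2≤b : 2 ℕ.≤ b) → ¬ ProperPower (+ b) →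
  (g : ℕ⁺ → ℝ) →
  (∀ m n → value m ℕ.≤ value n → g m ≤ g n) →
  (λ n → g (suc⁺ n)) ∼ g →
  (f : ℕ⁺ → ℕ⁺) →
  (∀ m n → value m ℕ.≤ value n → value (f m) ℕ.≤ value (f n)) →
  (λ n → f (suc⁺ n) /⁺ f n) ∼ g →
  Rational (concatenation b 2≤b f) →
  ∃[ c ] (g ⟶ c) × PowerOf b c ×
    Bounded (λ n → fromℕ (value (f (suc⁺ n))) - c * fromℕ (value (f n)))
theorem2 b 2≤b npp g _ g′∼g f f-mono f′/f∼g α-rational =
  conclude (growth (LongDivision.rational⇒remainders 2≤b (concat∞ blocks) α-rational))
  where
  blocks = λ i → digits b 2≤b (f (pos (suc i)))

  growth : ∃[ r ] ℕ.NonZero r × ∃[ t ] (∀ n → t n ℕ.≤ r) × Remainders r (concat∞ blocks) t →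
           ∃[ j ] NearlyGeometric (values f) (b ℕ.^ j)
  growth (r , r≢0 , t , t≤r , t-remainders) = Growth.nearlyGeometric 2≤b npp r≢0 (values f)
    (λ n → length (toList (blocks n))) (remainderBefore blocks t)
    (λ n → value-nonZero (f (pos (suc n))))
    (λ n → f-mono (pos (suc n)) (pos (suc (suc n))) (ℕ.n≤1+n (suc n)))
    (ratiosConverge {f} {g} g′∼g f′/f∼g)
    (remainderBefore-≤ blocks t≤r)
    (λ n → trans (read-word {r = r} blocks t-remainders n)
      (cong (λ v → r ℕ.* v ℕ.+ remainderBefore blocks t (suc n)) (numeral-digits b 2≤b (f (pos (suc n))))))

  conclude : ∃[ j ] NearlyGeometric (values f) (b ℕ.^ j) →
    ∃[ c ] (g ⟶ c) × PowerOf b c ×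
      Bounded (λ n → fromℕ (value (f (suc⁺ n))) - c * fromℕ (value (f n)))
  conclude (j , near) = fromℕ (b ℕ.^ j) ,
    nearlyGeometric⇒⟶ {f} {g} f′/f∼g near ,
    (j , ≃-refl (fromℕ (b ℕ.^ j))) ,
    nearlyGeometric⇒bounded {f} f-mono near
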